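{- Let $V$ be a finite set with $|V|\ge 2$ and let $\mathcal{P}=(P_t)_{t\ge1}$ be a sequence of irreducible and reversible transition matrices on $V$ which all have the same stationary distribution $\pi$. Let $(X_t)_{t\ge0}$ be a random walk according to $\mathcal{P}$ such that $X_0$ is sampled from $\pi$. Then, for any vertex $w\in V$ and any integer $T\ge0$, $$\Pr\left[\bigwedge_{t=0}^T\{X_t\ne w\}\right]\le\prod_{t=1}^T\left(1-\frac{1}{t_{\mathrm{hit}}(P_t)}\right)\le\exp\left(-\frac{T}{t_{\mathrm{HIT}}(\mathcal{P})}\right).$$
   Context: A transition matrix $P\in[0,1]^{V\times V}$ is a row-stochastic matrix. It is irreducible if for all $u,v$ there is $t>0$ with $P^t(u,v)>0$; reversible if $\pi(u)P(u,v)=\pi(v)P(v,u)$ for all $u,v$, where $\pi$ is its stationary distribution. A random walk according to $\mathcal{P}$ is a time-inhomogeneous Markov chain $(X_t)_{t\ge0}$ with $\Pr[X_t=v\mid X_{t-1}=u]=P_t(u,v)$ for $t\ge1$. $t_{\mathrm{hit}}(P)=\max_{u,w\in V}\mathbf{E}[\min\{t\ge 0:Y_t=w\}\mid Y_0=u]$ for the time-homogeneous chain $(Y_t)$ with transition matrix $P$; $t_{\mathrm{HIT}}(\mathcal{P})=\max_{t\ge 1}t_{\mathrm{hit}}(P_t)$ (read as a supremum, assumed finite). -}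

module Defs where

open import Level using (0ℓ)
open import Algebra.Bundles using (CommutativeRing; Semiring)
open import Axiom.ExcludedMiddle using (ExcludedMiddle)
open import Data.Bool.Base using (if_then_else_)
open import Data.Empty using (⊥)
open import Data.Fin.Base as Fin using (Fin; toℕ; inject₁)
open import Data.Nat.Base as ℕ using (ℕ; zero; suc)
open import Data.Product.Base using (∃; Σ-syntax; _×_; _,_; proj₁)
open import Data.Sum.Base using (_⊎_; inj₁; inj₂)
open import Data.Unit.Base using (⊤)
open import Data.Vec.Base using (Vec; []; _∷_; lookup)
open import Relation.Binary.Core using (Rel)
open import Relation.Binary.PropositionalEquality.Core as ≡ using (_≡_; _≢_)
open import Relation.Binary.Structures using (IsTotalOrder)
open import Relation.Nullary using (¬_; does; yes; no)
open import Relation.Unary using (Pred; U; ∁; ⋃; _∩_; _≐_)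
import Algebra.Definitions.RawSemiring as RawSemiringDefs
import Relation.Binary.Construct.NonStrictToStrict as Strict

-- Dedekind-complete ordered fields.  Classically ℝ is the only one up to
-- isomorphism, so a statement about an arbitrary such field, under excluded
-- middle, is a statement about the real numbers.  Equality is a setoid
-- equality, since quotients are not available.

record CompleteOrderedField : Set₁ where
  infix  4 _≤_
  infix  8 _⁻¹
  field
    commutativeRing : CommutativeRing 0ℓ 0ℓ

  open CommutativeRing commutativeRing public

  field
    -- 0# ⁻¹ is left unspecified.
    _⁻¹          : Carrier → Carrier
    ⁻¹-cong      : ∀ {x y} → x ≈ y → x ⁻¹ ≈ y ⁻¹
    ⁻¹-inverse   : ∀ {x} → x ≉ 0# → x ⁻¹ * x ≈ 1#
    1≉0          : 1# ≉ 0#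
    _≤_          : Rel Carrier 0ℓ
    isTotalOrder : IsTotalOrder _≈_ _≤_
    +-monoˡ-≤    : ∀ z {x y} → x ≤ y → x + z ≤ y + z
    *-nonNeg     : ∀ {x y} → 0# ≤ x → 0# ≤ y → 0# ≤ x * y

  UpperBound : Pred Carrier 0ℓ → Pred Carrier 0ℓ
  UpperBound S b = ∀ {x} → S x → x ≤ b

  IsSupremum : Pred Carrier 0ℓ → Pred Carrier 0ℓ
  IsSupremum S s = UpperBound S s × (∀ {b} → UpperBound S b → s ≤ b)

  field
    complete : ∀ S → ∃ S → ∃ (UpperBound S) → ∃ (IsSupremum S)

  open Strict _≈_ _≤_ public using (_<_)
  open RawSemiringDefs (Semiring.rawSemiring semiring) public using (sum; product; _^_) renaming (_×_ to _·_)

module MarkovChains (em : ExcludedMiddle 0ℓ) (ℝ : CompleteOrderedField) where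

  open CompleteOrderedField ℝ public

  infixl 7 _⊗_
  infix  4 _⟶_

  fromℕ : ℕ → Carrier
  fromℕ n = n · 1#

  indicator : Set → Carrier
  indicator A = if does (em {A}) then 1# else 0#

  _⟶_ : (ℕ → Carrier) → Carrier → Set
  s ⟶ l = ∀ ε → 0# < ε → Σ[ N ∈ ℕ ] (∀ n → N ℕ.≤ n → l - ε < s n × s n < l + ε)

  -- The value on a divergent sequence is 0#, by convention.
  lim : (ℕ → Carrier) → Carrier
  lim s with em {∃ (s ⟶_)}
  ... | yes (l , _) = l
  ... | no _        = 0#

  -- exp x = lim (1 + x/n)ⁿ, over n ≥ 1.
  exp : Carrier → Carrier
  exp x = lim (λ n → (1# + x * fromℕ (suc n) ⁻¹) ^ suc n)

  -- Values in [0,∞]; only non-negative arguments are ever given to fin.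
  data Extended : Set where
    fin : Carrier → Extended
    ∞   : Extended

  IsFinite : Extended → Set
  IsFinite (fin _) = ⊤
  IsFinite ∞       = ⊥

  -- The reciprocal, with 1/∞ = 0.
  recip : Extended → Carrier
  recip (fin x) = x ⁻¹
  recip ∞       = 0#

  BoundedBy : {I : Set} → (I → Extended) → Carrier → Set
  BoundedBy f b = 0# ≤ b × (∀ i → ∃ λ x → f i ≡ fin x × x ≤ b)

  -- Suprema in [0,∞].  Including 0 among the values changes nothing there, and
  -- gives the empty family its supremum 0.
  Values : {I : Set} → (I → Extended) → Pred Carrier 0ℓ
  Values f x = x ≈ 0# ⊎ (∃ λ i → f i ≡ fin x)

  values-bounded : {I : Set} {f : I → Extended} {b : Carrier} →
                   BoundedBy f b → UpperBound (Values f) b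
  values-bounded (0≤b , _) (inj₁ x≈0) = ≤-respˡ-≈ (sym x≈0) 0≤b
    where open IsTotalOrder isTotalOrder using (≤-respˡ-≈)
  values-bounded (_ , f≤b) (inj₂ (i , fi≡x)) with f≤b i
  ... | _ , fi≡y , y≤b
    with ≡.refl ← ≡.trans (≡.sym fi≡x) fi≡y = y≤b

  ⨆ : {I : Set} → (I → Extended) → Extended
  ⨆ f with em {∃ (BoundedBy f)}
  ... | yes (b , f≤b) = fin (proj₁ (complete (Values f) (0# , inj₁ refl) (b , values-bounded f≤b)))
  ... | no _          = ∞

  -- The sum of a series with non-negative terms.
  ∑∞ : (ℕ → Carrier) → Extended
  ∑∞ a = ⨆ (λ N → fin (sum {N} (λ t → a (toℕ t))))

  Matrix : ℕ → Set
  Matrix n = Fin n → Fin n → Carrier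

  _⊗_ : ∀ {n} → Matrix n → Matrix n → Matrix n
  (A ⊗ B) u v = sum (λ x → A u x * B x v)

  power : ∀ {n} → Matrix n → ℕ → Matrix n
  power P zero    u v = indicator (u ≡ v)
  power P (suc t)     = P ⊗ power P t

  record IsTransition {n} (P : Matrix n) : Set where
    field
      nonNeg     : ∀ u v → 0# ≤ P u v
      ≤1         : ∀ u v → P u v ≤ 1#
      stochastic : ∀ u → sum (P u) ≈ 1#

  Irreducible : ∀ {n} → Matrix n → Set
  Irreducible P = ∀ u v → Σ[ t ∈ ℕ ] (0 ℕ.< t × 0# < power P t u v)

  record IsStationary {n} (π : Fin n → Carrier) (P : Matrix n) : Set where
    field
      nonNeg    : ∀ v → 0# ≤ π v
      total     : sum π ≈ 1#
      invariant : ∀ v → sum (λ u → π u * P u v) ≈ π v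

  Reversible : ∀ {n} → (Fin n → Carrier) → Matrix n → Set
  Reversible π P = ∀ u v → π u * P u v ≈ π v * P v u

  sumVec : ∀ {n} t → (Vec (Fin n) t → Carrier) → Carrier
  sumVec zero    f = f []
  sumVec (suc t) f = sum (λ v → sumVec t (λ ys → f (v ∷ ys)))

  -- Pr[ Y₁ = y₁ , … , Yₜ = yₜ ∣ Y₀ = u ] for the time-homogeneous chain Y.
  pathProb : ∀ {n t} → Matrix n → Fin n → Vec (Fin n) t → Carrier
  pathProb P u []       = 1#
  pathProb P u (y ∷ ys) = P u y * pathProb P y ys

  -- min { s ≥ 0 : Yₛ = w } = t, for the trajectory Y₀ , … , Yₜ.
  FirstHit : ∀ {n t} → Fin n → Vec (Fin n) (suc t) → Set
  FirstHit {t = t} w ys = (∀ s → lookup ys (inject₁ s) ≢ w) × lookup ys (Fin.fromℕ t) ≡ w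

  hitProb : ∀ {n} → Matrix n → Fin n → Fin n → ℕ → Carrier
  hitProb P u w t = sumVec t (λ ys → indicator (FirstHit w (u ∷ ys)) * pathProb P u ys)

  -- The hitting time of an irreducible chain is almost surely finite, so its
  -- expectation has no contribution from the value ∞.
  expectedHit : ∀ {n} → Matrix n → Fin n → Fin n → Extended
  expectedHit P u w = ∑∞ (λ t → fromℕ t * hitProb P u w t)

  -- A supremum over a finite set, hence a maximum.
  tHit : ∀ {n} → Matrix n → Extended
  tHit {n} P = ⨆ {Fin n × Fin n} (λ (u , w) → expectedHit P u w)

  -- Sequences (Pₜ) for t ≥ 1 are shifted throughout: P t is Pₜ₊₁, the matrix
  -- governing the step from time t to time t + 1.
  tHIT : ∀ {n} → (ℕ → Matrix n) → Extended
  tHIT P = ⨆ (λ t → tHit (P t))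

  record ProbabilitySpace : Set₂ where
    field
      Ω          : Set
      Measurable : Pred Ω 0ℓ → Set₁
      -- Pr is unconstrained outside the σ-algebra.
      Pr         : Pred Ω 0ℓ → Carrier

      measurable-resp : ∀ {A B} → A ≐ B → Measurable A → Measurable B
      measurable-U    : Measurable U
      measurable-∁    : ∀ {A} → Measurable A → Measurable (∁ A)
      measurable-⋃    : ∀ (A : ℕ → Pred Ω 0ℓ) → (∀ i → Measurable (A i)) → Measurable (⋃ ℕ A)

      Pr-cong     : ∀ {A B} → A ≐ B → Measurable A → Pr A ≈ Pr B
      Pr-nonNeg   : ∀ {A} → Measurable A → 0# ≤ Pr A
      Pr-U        : Pr U ≈ 1#
      Pr-additive : ∀ (A : ℕ → Pred Ω 0ℓ) → (∀ i → Measurable (A i)) →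
                    (∀ i j → i ≢ j → ∀ ω → A i ω → ¬ A j ω) →
                    (λ N → sum {N} (λ i → Pr (A (toℕ i)))) ⟶ Pr (⋃ ℕ A)

    Pr[_∣_] : Pred Ω 0ℓ → Pred Ω 0ℓ → Carrier
    Pr[ A ∣ B ] = Pr (A ∩ B) * Pr B ⁻¹

  record RandomWalk {n} (P : ℕ → Matrix n) : Set₂ where
    field
      space : ProbabilitySpace
    open ProbabilitySpace space public
    field
      X            : ℕ → Ω → Fin n
      X-measurable : ∀ t v → Measurable (λ ω → X t ω ≡ v)

    -- X agrees with x at the times 0 , … , t; the later values of x are irrelevant.
    History : ℕ → (ℕ → Fin n) → Pred Ω 0ℓ
    History t x ω = ∀ s → s ℕ.≤ t → X s ω ≡ x s

    field
      markov     : ∀ t x v → 0# < Pr (History t x) →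
                   Pr[ (λ ω → X (suc t) ω ≡ v) ∣ History t x ] ≈
                   Pr[ (λ ω → X (suc t) ω ≡ v) ∣ (λ ω → X t ω ≡ x t) ]
      transition : ∀ t u v → 0# < Pr (λ ω → X t ω ≡ u) →
                   Pr[ (λ ω → X (suc t) ω ≡ v) ∣ (λ ω → X t ω ≡ u) ] ≈ P t u v

{-# OPTIONS --safe #-}
module Submission where

-- Off w, the expected time h to hit w satisfies P h = h − 1 ≤ (1 − 1/t_hit(P)) h;
-- irreducibility enters through the 1, as w is hit almost surely.  By reversibility,
-- P with the row and column of w deleted is self-adjoint for the inner product
-- weighted by π, so Schur's test with the test function h bounds its norm by
-- 1 − 1/t_hit(P), without any spectral theory.  Applying these operators for
-- t = 1 , … , T to the constant 1 gives the probability of avoiding w as a function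
-- of the starting point, and Cauchy–Schwarz bounds its π-average by the norm.
-- For the exponential bound, (1 + x/n)ⁿ with x = −T/t_HIT increases from n = T on,
-- where its value is (1 − 1/t_HIT)ᵀ.

open import Defs
open import Level using (0ℓ)
open import Axiom.ExcludedMiddle using (ExcludedMiddle)
open import Data.Fin.Base using (Fin; zero; suc; toℕ; fromℕ<)
open import Data.Fin.Properties using (suc-injective; toℕ<n; toℕ-injective; toℕ-fromℕ<)
open import Data.Nat.Base as ℕ using (ℕ; zero; suc)
import Data.Nat.Properties as ℕ
open import Data.Vec.Base using (Vec; []; _∷_)
open import Data.Product.Base using (_×_; _,_; proj₁; proj₂; ∃)
open import Data.Sum.Base using (inj₁; inj₂)
open import Data.Bool.Base using (if_then_else_)
open import Data.Empty using (⊥)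
open import Data.Unit.Base using (tt)
open import Function.Base using (_∘_)
open import Relation.Binary.Bundles using (Poset)
open import Relation.Binary.PropositionalEquality.Core as ≡ using (_≡_; _≢_)
open import Relation.Binary.Structures using (IsTotalOrder)
open import Relation.Nullary using (¬_; does; yes; no; contradiction)
open import Relation.Nullary.Decidable using (decidable-stable)
open import Relation.Unary using (Pred; ∁; ⋃; _∩_; _≐_)
open import Relation.Unary.Properties using (≐-sym)
import Algebra.Properties.Ring as RingProperties
import Algebra.Properties.Semiring.Sum as SemiringSum
import Algebra.Solver.Ring.NaturalCoefficients.Default as SemiringSolver
import Relation.Binary.Reasoning.PartialOrder as PartialOrderReasoning

-- Each `P t` with `w` deleted contracts the sup norm weighted by its own expected hitting times
-- `h`, but `h` changes with t, so such bounds do not compose along the sequence. All these matrices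
-- are self-adjoint in the one space L²(π): Schur's test turns the private test function of each
-- step into a bound in this common norm, and there the factors multiply. A test function only has
-- to satisfy P h ≤ c h off `w`, so the probabilistic inputs can all be one-sided: hitting times
-- enter through 1 + P h ≤ h, and the law of the walk through an upper bound on the probability of
-- avoidance, for which histories of probability zero are harmless. Expectations are suprema of
-- partial sums, so P is applied to truncated sums and then carried through the suprema; the term 1
-- is the P-average of the probabilities of ever hitting `w`.

-- Ordered-field arithmetic, finite sums, Cauchy-Schwarz and suprema of sums.

module OrderedField (em : ExcludedMiddle 0ℓ) (ℝ : CompleteOrderedField) where

  open CompleteOrderedField ℝ hiding (zero)
  open IsTotalOrder isTotalOrder public
    using (isPartialOrder; antisym; total)
    renaming (refl to ≤-refl; reflexive to ≤-reflexive; trans to ≤-trans; ≤-respˡ-≈ to ≤-respˡ; ≤-respʳ-≈ to ≤-respʳ)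
  open SemiringSum semiring public
    using (sum-cong-≋; sum-replicate-zero; ∑-distrib-+; ∑-comm; *-distribˡ-sum; *-distribʳ-sum)
  open RingProperties ring public
    using (-‿involutive; -‿distribˡ-*; -‿distribʳ-*; -0#≈0#; [y-z]x≈yx-zx; x[y-z]≈xy-xz)
    renaming (//-rightDividesˡ to x-y+y≈x; //-rightDividesʳ to x+y-y≈x; ⁻¹-anti-homo‿- to -[x-y]≈y-x)
  module Solver = SemiringSolver commutativeSemiring

  poset : Poset 0ℓ 0ℓ 0ℓ
  poset = record { isPartialOrder = isPartialOrder }

  module ≤-Reasoning = PartialOrderReasoning poset
  open ≤-Reasoning

  +-mono-≤ : ∀ {x y u v} → x ≤ y → u ≤ v → x + u ≤ y + v
  +-mono-≤ {x} {y} {u} {v} x≤y u≤v = begin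
    x + u ≤⟨ +-monoˡ-≤ u x≤y ⟩
    y + u ≈⟨ +-comm y u ⟩
    u + y ≤⟨ +-monoˡ-≤ y u≤v ⟩
    v + y ≈⟨ +-comm v y ⟩
    y + v ∎

  x+y≤z⇒x≤z-y : ∀ {x y z} → x + y ≤ z → x ≤ z - y
  x+y≤z⇒x≤z-y {x} {y} {z} p = begin
    x         ≈⟨ x+y-y≈x y x ⟨
    x + y - y ≤⟨ +-monoˡ-≤ (- y) p ⟩
    z - y     ∎

  x≤z-y⇒x+y≤z : ∀ {x y z} → x ≤ z - y → x + y ≤ z
  x≤z-y⇒x+y≤z {x} {y} {z} p = begin
    x + y     ≤⟨ +-monoˡ-≤ y p ⟩
    z - y + y ≈⟨ x-y+y≈x y z ⟩
    z         ∎

  x-[x-y]≈y : ∀ x y → x - (x - y) ≈ y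
  x-[x-y]≈y x y = trans (+-congˡ (-[x-y]≈y-x x y)) (trans (+-comm x _) (x-y+y≈x x y))

  x≤y⇒0≤y-x : ∀ {x y} → x ≤ y → 0# ≤ y - x
  x≤y⇒0≤y-x {x} x≤y = x+y≤z⇒x≤z-y (≤-respˡ (sym (+-identityˡ x)) x≤y)

  0≤y-x⇒x≤y : ∀ {x y} → 0# ≤ y - x → x ≤ y
  0≤y-x⇒x≤y {x} p = ≤-respˡ (+-identityˡ x) (x≤z-y⇒x+y≤z p)

  +-cancelʳ-≤ : ∀ {x y} z → x + z ≤ y + z → x ≤ y
  +-cancelʳ-≤ {x} {y} z p = ≤-respʳ (x+y-y≈x z y) (x+y≤z⇒x≤z-y p)

  neg-antitone : ∀ {x y} → x ≤ y → - y ≤ - x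
  neg-antitone {x} {y} x≤y = +-cancelʳ-≤ y (begin
    - y + y ≈⟨ -‿inverseˡ y ⟩
    0#      ≈⟨ -‿inverseˡ x ⟨
    - x + x ≤⟨ +-mono-≤ ≤-refl x≤y ⟩
    - x + y ∎)

  x≤0⇒0≤-x : ∀ {x} → x ≤ 0# → 0# ≤ - x
  x≤0⇒0≤-x x≤0 = ≤-respˡ -0#≈0# (neg-antitone x≤0)

  *-monoˡ-≤ : ∀ {x y z} → 0# ≤ z → x ≤ y → z * x ≤ z * y
  *-monoˡ-≤ {x} {y} {z} 0≤z x≤y =
    0≤y-x⇒x≤y (≤-respʳ (x[y-z]≈xy-xz z y x) (*-nonNeg 0≤z (x≤y⇒0≤y-x x≤y)))

  *-monoʳ-≤ : ∀ {x y z} → 0# ≤ z → x ≤ y → x * z ≤ y * z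
  *-monoʳ-≤ {x} {y} {z} 0≤z x≤y =
    0≤y-x⇒x≤y (≤-respʳ ([y-z]x≈yx-zx z y x) (*-nonNeg (x≤y⇒0≤y-x x≤y) 0≤z))

  *-mono-≤ : ∀ {x y u v} → 0# ≤ y → 0# ≤ u → x ≤ y → u ≤ v → x * u ≤ y * v
  *-mono-≤ 0≤y 0≤u x≤y u≤v = ≤-trans (*-monoʳ-≤ 0≤u x≤y) (*-monoˡ-≤ 0≤y u≤v)

  0≤x² : ∀ x → 0# ≤ x * x
  0≤x² x with total 0# x
  ... | inj₁ 0≤x = *-nonNeg 0≤x 0≤x
  ... | inj₂ x≤0 = begin
    0#          ≤⟨ *-nonNeg (x≤0⇒0≤-x x≤0) (x≤0⇒0≤-x x≤0) ⟩
    - x * - x   ≈⟨ -‿distribˡ-* x (- x) ⟨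
    - (x * - x) ≈⟨ -‿cong (sym (-‿distribʳ-* x x)) ⟩
    - - (x * x) ≈⟨ -‿involutive (x * x) ⟩
    x * x       ∎

  0≤1 : 0# ≤ 1#
  0≤1 = ≤-respʳ (*-identityˡ 1#) (0≤x² 1#)

  0<1 : 0# < 1#
  0<1 = 0≤1 , 1≉0 ∘ sym

  2xy≤x²+y² : ∀ x y → x * y + x * y ≤ x * x + y * y
  2xy≤x²+y² x y = begin
    x * y + x * y                     ≈⟨ +-cong (*-congʳ x≈d+y) (*-congʳ x≈d+y) ⟩
    (d + y) * y + (d + y) * y         ≈⟨ +-identityˡ _ ⟨
    0# + ((d + y) * y + (d + y) * y)  ≤⟨ +-monoˡ-≤ _ (0≤x² d) ⟩
    d * d + ((d + y) * y + (d + y) * y)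
      ≈⟨ Solver.solve 2 (λ d y → d :* d :+ ((d :+ y) :* y :+ (d :+ y) :* y) := (d :+ y) :* (d :+ y) :+ y :* y) refl d y ⟩
    (d + y) * (d + y) + y * y         ≈⟨ +-congʳ (*-cong x≈d+y x≈d+y) ⟨
    x * x + y * y                     ∎
    where
    open Solver using (_:*_; _:+_; _:=_)
    -- Substituting x = d + y leaves an identity without subtraction, 2xy + d² = x² + y², which the
    -- semiring solver can check.
    d = x - y
    x≈d+y : x ≈ d + y
    x≈d+y = sym (x-y+y≈x y x)

  <⇒≱ : ∀ {x y} → x < y → ¬ y ≤ x
  <⇒≱ (x≤y , x≉y) y≤x = x≉y (antisym x≤y y≤x)

  <-≤-trans : ∀ {x y z} → x < y → y ≤ z → x < z
  <-≤-trans x<y@(x≤y , _) y≤z = ≤-trans x≤y y≤z , λ x≈z → <⇒≱ x<y (≤-respʳ (sym x≈z) y≤z)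

  ≤-<-trans : ∀ {x y z} → x ≤ y → y < z → x < z
  ≤-<-trans x≤y y<z@(y≤z , _) = ≤-trans x≤y y≤z , λ x≈z → <⇒≱ y<z (≤-respˡ x≈z x≤y)

  ⁻¹-inverseʳ : ∀ {x} → x ≉ 0# → x * x ⁻¹ ≈ 1#
  ⁻¹-inverseʳ {x} x≉0 = trans (*-comm x (x ⁻¹)) (⁻¹-inverse x≉0)

  0<x⇒0≤x⁻¹ : ∀ {x} → 0# < x → 0# ≤ x ⁻¹
  0<x⇒0≤x⁻¹ {x} (0≤x , 0≉x) with total 0# (x ⁻¹)
  ... | inj₁ 0≤x⁻¹ = 0≤x⁻¹
  ... | inj₂ x⁻¹≤0 = contradiction 1≤0 (<⇒≱ 0<1)
    where
    1≤0 : 1# ≤ 0#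
    1≤0 = begin
      1#        ≈⟨ ⁻¹-inverseʳ (0≉x ∘ sym) ⟨
      x * x ⁻¹  ≤⟨ *-monoˡ-≤ 0≤x x⁻¹≤0 ⟩
      x * 0#    ≈⟨ zeroʳ x ⟩
      0#        ∎

  1⁻¹≈1 : 1# ⁻¹ ≈ 1#
  1⁻¹≈1 = trans (sym (*-identityʳ _)) (⁻¹-inverse 1≉0)

  x*z*z⁻¹≈x : ∀ x {z} → z ≉ 0# → x * z * z ⁻¹ ≈ x
  x*z*z⁻¹≈x x {z} z≉0 = trans (*-assoc x z (z ⁻¹)) (trans (*-congˡ (⁻¹-inverseʳ z≉0)) (*-identityʳ x))

  *-cancelʳ-≤ : ∀ {x y z} → 0# < z → x * z ≤ y * z → x ≤ y
  *-cancelʳ-≤ {x} {y} {z} 0<z p = begin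
    x            ≈⟨ x*z*z⁻¹≈x x (proj₂ 0<z ∘ sym) ⟨
    x * z * z ⁻¹ ≤⟨ *-monoʳ-≤ (0<x⇒0≤x⁻¹ 0<z) p ⟩
    y * z * z ⁻¹ ≈⟨ x*z*z⁻¹≈x y (proj₂ 0<z ∘ sym) ⟩
    y            ∎

  ⁻¹-antitone : ∀ {x y} → 0# < x → x ≤ y → y ⁻¹ ≤ x ⁻¹
  ⁻¹-antitone {x} {y} 0<x x≤y = *-cancelʳ-≤ 0<y (begin
    y ⁻¹ * y ≈⟨ ⁻¹-inverse (proj₂ 0<y ∘ sym) ⟩
    1#       ≈⟨ ⁻¹-inverse (proj₂ 0<x ∘ sym) ⟨
    x ⁻¹ * x ≤⟨ *-monoˡ-≤ (0<x⇒0≤x⁻¹ 0<x) x≤y ⟩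
    x ⁻¹ * y ∎)
    where
    0<y = <-≤-trans 0<x x≤y

  ≮⇒≥ : ∀ {x y} → ¬ x < y → y ≤ x
  ≮⇒≥ {x} {y} x≮y with total x y
  ... | inj₂ y≤x = y≤x
  ... | inj₁ x≤y with em {x ≈ y}
  ...   | yes x≈y = ≤-reflexive (sym x≈y)
  ...   | no x≉y  = contradiction (x≤y , x≉y) x≮y

  -- This takes the place of a square root: norms are kept squared throughout, and the squares are
  -- removed once at the end.
  x²≤y²⇒x≤y : ∀ {x y} → 0# ≤ y → x * x ≤ y * y → x ≤ y
  x²≤y²⇒x≤y {x} {y} 0≤y x²≤y² = ≮⇒≥ λ y<x → <⇒≱ y<x (*-cancelʳ-≤ (≤-<-trans 0≤y y<x) (begin
    x * x ≤⟨ x²≤y² ⟩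
    y * y ≤⟨ *-monoˡ-≤ 0≤y (proj₁ y<x) ⟩
    y * x ∎))

  sum-mono : ∀ {n} {f g : Fin n → Carrier} → (∀ i → f i ≤ g i) → sum f ≤ sum g
  sum-mono {zero}  f≤g = ≤-refl
  sum-mono {suc n} f≤g = +-mono-≤ (f≤g zero) (sum-mono (f≤g ∘ suc))

  sum-nonNeg : ∀ {n} {f : Fin n → Carrier} → (∀ i → 0# ≤ f i) → 0# ≤ sum f
  sum-nonNeg {zero}  0≤f = ≤-refl
  sum-nonNeg {suc n} 0≤f = ≤-respˡ (+-identityˡ 0#) (+-mono-≤ (0≤f zero) (sum-nonNeg (0≤f ∘ suc)))

  sum-zero : ∀ {n} {f : Fin n → Carrier} → (∀ i → f i ≈ 0#) → sum f ≈ 0#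
  sum-zero {n} f≈0 = trans (sum-cong-≋ f≈0) (sum-replicate-zero n)

  sum-mono-length : ∀ {a : ℕ → Carrier} → (∀ t → 0# ≤ a t) → ∀ {M N} → M ℕ.≤ N →
                    sum {M} (a ∘ toℕ) ≤ sum {N} (a ∘ toℕ)
  sum-mono-length 0≤a {N = N} ℕ.z≤n = sum-nonNeg {N} (0≤a ∘ toℕ)
  sum-mono-length 0≤a (ℕ.s≤s M≤N)   = +-mono-≤ ≤-refl (sum-mono-length (0≤a ∘ suc) M≤N)

  sum-extend : ∀ {a : ℕ → Carrier} {m N} → m ℕ.≤ N → (∀ i → m ℕ.≤ i → a i ≈ 0#) →
               sum {N} (a ∘ toℕ) ≈ sum {m} (a ∘ toℕ)
  sum-extend {N = N} ℕ.z≤n a≈0       = sum-zero {N} λ i → a≈0 (toℕ i) ℕ.z≤n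
  sum-extend         (ℕ.s≤s m≤N) a≈0 = +-congˡ (sum-extend m≤N λ i m≤i → a≈0 (suc i) (ℕ.s≤s m≤i))

  term≤sum : ∀ {n} {f : Fin n → Carrier} → (∀ i → 0# ≤ f i) → ∀ i → f i ≤ sum f
  term≤sum {f = f} 0≤f zero    = ≤-respˡ (+-identityʳ (f zero)) (+-mono-≤ ≤-refl (sum-nonNeg (0≤f ∘ suc)))
  term≤sum {f = f} 0≤f (suc i) = ≤-respˡ (+-identityˡ (f (suc i))) (+-mono-≤ (0≤f zero) (term≤sum (0≤f ∘ suc) i))

  product-nonNeg : ∀ {n} {f : Fin n → Carrier} → (∀ i → 0# ≤ f i) → 0# ≤ product f
  product-nonNeg {zero}  0≤f = 0≤1
  product-nonNeg {suc n} 0≤f = *-nonNeg (0≤f zero) (product-nonNeg (0≤f ∘ suc))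

  product≤^ : ∀ {n c} {f : Fin n → Carrier} → 0# ≤ c → (∀ i → 0# ≤ f i) → (∀ i → f i ≤ c) → product f ≤ c ^ n
  product≤^ {zero}  0≤c 0≤f f≤c = ≤-refl
  product≤^ {suc n} 0≤c 0≤f f≤c =
    *-mono-≤ 0≤c (product-nonNeg (0≤f ∘ suc)) (f≤c zero) (product≤^ 0≤c (0≤f ∘ suc) (f≤c ∘ suc))

  ^-nonNeg : ∀ {x} → 0# ≤ x → ∀ n → 0# ≤ x ^ n
  ^-nonNeg 0≤x zero    = 0≤1
  ^-nonNeg 0≤x (suc n) = *-nonNeg 0≤x (^-nonNeg 0≤x n)

  ^-mono : ∀ {x y} → 0# ≤ x → x ≤ y → ∀ n → x ^ n ≤ y ^ n
  ^-mono 0≤x x≤y zero    = ≤-refl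
  ^-mono 0≤x x≤y (suc n) = *-mono-≤ (≤-trans 0≤x x≤y) (^-nonNeg 0≤x n) x≤y (^-mono 0≤x x≤y n)

  1^n≈1 : ∀ n → 1# ^ n ≈ 1#
  1^n≈1 zero    = refl
  1^n≈1 (suc n) = trans (*-identityˡ (1# ^ n)) (1^n≈1 n)

  -- Non-negativity of the second moment of y about z.
  2z·Σcy≤Σcy²+z²·Σc : ∀ {n} (c y : Fin n → Carrier) → (∀ i → 0# ≤ c i) → ∀ z →
    sum (λ i → c i * y i) * z + sum (λ i → c i * y i) * z ≤
    sum (λ i → c i * (y i * y i)) + sum c * (z * z)
  2z·Σcy≤Σcy²+z²·Σc {zero} c y 0≤c z =
    ≤-reflexive (+-cong (zeroˡ z) (trans (zeroˡ z) (sym (zeroˡ (z * z)))))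
  2z·Σcy≤Σcy²+z²·Σc {suc n} c y 0≤c z = begin
    (c₀ * y₀ + S₁) * z + (c₀ * y₀ + S₁) * z
      ≈⟨ solve 4 (λ c y S z → (c :* y :+ S) :* z :+ (c :* y :+ S) :* z
                           := c :* (y :* z :+ y :* z) :+ (S :* z :+ S :* z)) refl c₀ y₀ S₁ z ⟩
    c₀ * (y₀ * z + y₀ * z) + (S₁ * z + S₁ * z)
      ≤⟨ +-mono-≤ (*-monoˡ-≤ (0≤c zero) (2xy≤x²+y² y₀ z)) (2z·Σcy≤Σcy²+z²·Σc (c ∘ suc) (y ∘ suc) (0≤c ∘ suc) z) ⟩
    c₀ * (y₀ * y₀ + z * z) + (S₂ + S₀ * (z * z))
      ≈⟨ solve 5 (λ c y S₀ S₂ z → c :* (y :* y :+ z :* z) :+ (S₂ :+ S₀ :* (z :* z))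
                           := (c :* (y :* y) :+ S₂) :+ (c :+ S₀) :* (z :* z)) refl c₀ y₀ S₀ S₂ z ⟩
    (c₀ * (y₀ * y₀) + S₂) + (c₀ + S₀) * (z * z) ∎
    where
    open Solver using (solve; _:*_; _:+_; _:=_)
    c₀ = c zero
    y₀ = y zero
    S₀ = sum (c ∘ suc)
    S₁ = sum (λ i → c (suc i) * y (suc i))
    S₂ = sum (λ i → c (suc i) * (y (suc i) * y (suc i)))

  -- Induction on n. Expanding the square leaves the cross term `c₀ * (S₁ * y₀ + S₁ * y₀)`; the
  -- moment inequality above, at z = `y₀`, bounds it by `c₀ * (S₂ + S₀ * (y₀ * y₀))`, which is
  -- exactly the mixed part of the product on the right. No division occurs, so weights may vanish.
  cauchy-schwarz : ∀ {n} (c y : Fin n → Carrier) → (∀ i → 0# ≤ c i) →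
    sum (λ i → c i * y i) * sum (λ i → c i * y i) ≤ sum c * sum (λ i → c i * (y i * y i))
  cauchy-schwarz {zero}  c y 0≤c = ≤-refl
  cauchy-schwarz {suc n} c y 0≤c = begin
    (c₀ * y₀ + S₁) * (c₀ * y₀ + S₁)
      ≈⟨ solve 3 (λ c y S → (c :* y :+ S) :* (c :* y :+ S)
                         := (c :* c :* y :* y :+ c :* (S :* y :+ S :* y)) :+ S :* S) refl c₀ y₀ S₁ ⟩
    (c₀ * c₀ * y₀ * y₀ + c₀ * (S₁ * y₀ + S₁ * y₀)) + S₁ * S₁
      ≤⟨ +-mono-≤ (+-mono-≤ ≤-refl (*-monoˡ-≤ (0≤c zero) (2z·Σcy≤Σcy²+z²·Σc (c ∘ suc) (y ∘ suc) (0≤c ∘ suc) y₀)))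
                  (cauchy-schwarz (c ∘ suc) (y ∘ suc) (0≤c ∘ suc)) ⟩
    (c₀ * c₀ * y₀ * y₀ + c₀ * (S₂ + S₀ * (y₀ * y₀))) + S₀ * S₂
      ≈⟨ solve 4 (λ c y S₀ S₂ → (c :* c :* y :* y :+ c :* (S₂ :+ S₀ :* (y :* y))) :+ S₀ :* S₂
                             := (c :+ S₀) :* (c :* (y :* y) :+ S₂)) refl c₀ y₀ S₀ S₂ ⟩
    (c₀ + S₀) * (c₀ * (y₀ * y₀) + S₂) ∎
    where
    open Solver using (solve; _:*_; _:+_; _:=_)
    c₀ = c zero
    y₀ = y zero
    S₀ = sum (c ∘ suc)
    S₁ = sum (λ i → c (suc i) * y (suc i))
    S₂ = sum (λ i → c (suc i) * (y (suc i) * y (suc i)))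

  Monotone : (ℕ → Carrier) → Set
  Monotone a = ∀ {M N} → M ℕ.≤ N → a M ≤ a N

  Least : (ℕ → Carrier) → Carrier → Set
  Least a s = ∀ {x} → (∀ N → a N ≤ x) → s ≤ x

  -- Monotone convergence for a finite weighted sum, by which a row of `P` passes through the
  -- suprema defining hitting probabilities and expected times. The suprema are taken one coordinate
  -- at a time: with the head held at index M and the tail at N, both are compared with their values
  -- at N ⊔ M.
  sum-sup-≤ : ∀ {n} (c : Fin n → Carrier) → (∀ v → 0# ≤ c v) →
              (a : Fin n → ℕ → Carrier) → (∀ v → Monotone (a v)) →
              (s : Fin n → Carrier) → (∀ v → Least (a v) (s v)) →
              ∀ {b} → (∀ N → sum (λ v → c v * a v N) ≤ b) → sum (λ v → c v * s v) ≤ b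
  sum-sup-≤ {zero}  c 0≤c a mono s least p = p 0
  sum-sup-≤ {suc n} c 0≤c a mono s least {b} p = begin
    c₀ * s₀ + R ≤⟨ +-monoˡ-≤ R c₀s₀≤b-R ⟩
    b - R + R   ≈⟨ x-y+y≈x R b ⟩
    b           ∎
    where
    c₀ = c zero
    s₀ = s zero
    R  = sum (λ v → c (suc v) * s (suc v))

    tail≤ : ∀ M → R ≤ b - c₀ * a zero M
    tail≤ M = sum-sup-≤ (c ∘ suc) (0≤c ∘ suc) (a ∘ suc) (mono ∘ suc) (s ∘ suc) (least ∘ suc) λ N →
      x+y≤z⇒x≤z-y (begin
        sum (λ v → c (suc v) * a (suc v) N) + c₀ * a zero M ≈⟨ +-comm _ _ ⟩
        c₀ * a zero M + sum (λ v → c (suc v) * a (suc v) N)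
          ≤⟨ +-mono-≤ (*-monoˡ-≤ (0≤c zero) (mono zero (ℕ.m≤n⊔m N M)))
                      (sum-mono (λ v → *-monoˡ-≤ (0≤c (suc v)) (mono (suc v) (ℕ.m≤m⊔n N M)))) ⟩
        sum (λ v → c v * a v (N ℕ.⊔ M))                     ≤⟨ p (N ℕ.⊔ M) ⟩
        b ∎)

    head≤ : ∀ M → c₀ * a zero M ≤ b - R
    head≤ M = x+y≤z⇒x≤z-y (≤-respˡ (+-comm _ _) (x≤z-y⇒x+y≤z (tail≤ M)))

    c₀s₀≤b-R : c₀ * s₀ ≤ b - R
    -- A zero weight cannot be cancelled from `head≤`, but then `c₀ * s₀` equals `c₀ * a zero 0`,
    -- and the single index 0 suffices.
    c₀s₀≤b-R with em {0# ≈ c₀}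
    ... | yes 0≈c₀ = begin
      c₀ * s₀       ≈⟨ *-congʳ 0≈c₀ ⟨
      0# * s₀       ≈⟨ zeroˡ s₀ ⟩
      0#            ≈⟨ zeroˡ (a zero 0) ⟨
      0# * a zero 0 ≈⟨ *-congʳ 0≈c₀ ⟩
      c₀ * a zero 0 ≤⟨ head≤ 0 ⟩
      b - R         ∎
    ... | no 0≉c₀ = begin
      c₀ * s₀                  ≈⟨ *-comm c₀ s₀ ⟩
      s₀ * c₀                  ≤⟨ *-monoʳ-≤ (0≤c zero) (least zero (λ N → *-cancelʳ-≤ (0≤c zero , 0≉c₀) (begin
        a zero N * c₀            ≈⟨ *-comm _ c₀ ⟩
        c₀ * a zero N            ≤⟨ head≤ N ⟩
        b - R                    ≈⟨ x*z⁻¹*z≈x ⟨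
        (b - R) * c₀ ⁻¹ * c₀     ∎))) ⟩
      (b - R) * c₀ ⁻¹ * c₀     ≈⟨ x*z⁻¹*z≈x ⟩
      b - R                    ∎
      where
      x*z⁻¹*z≈x : (b - R) * c₀ ⁻¹ * c₀ ≈ b - R
      x*z⁻¹*z≈x = trans (*-assoc _ _ _) (trans (*-congˡ (⁻¹-inverse (0≉c₀ ∘ sym))) (*-identityʳ _))

  bounded⇒supremum : ∀ (a : ℕ → Carrier) {b} → (∀ N → a N ≤ b) → ∃ λ s → (∀ N → a N ≤ s) × Least a s
  bounded⇒supremum a {b} a≤b
    with complete (λ x → ∃ λ N → a N ≈ x) (a 0 , 0 , refl) (b , λ (N , aN≈x) → ≤-respˡ aN≈x (a≤b N))
  ... | s , upper , least = s , (λ N → upper (N , refl)) , λ a≤x → least λ (N , aN≈x) → ≤-respˡ aN≈x (a≤x N)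

  sum-single : ∀ {n} {f : Fin n → Carrier} i → (∀ j → i ≢ j → f j ≈ 0#) → sum f ≈ f i
  sum-single {f = f} zero    f≈0 = trans (+-congˡ (sum-zero λ j → f≈0 (suc j) λ ())) (+-identityʳ (f zero))
  sum-single {f = f} (suc i) f≈0 =
    trans (+-cong (f≈0 zero λ ()) (sum-single i λ j i≢j → f≈0 (suc j) (i≢j ∘ suc-injective))) (+-identityˡ (f (suc i)))

  argmin : ∀ {n} (f : Fin (suc n) → Carrier) → ∃ λ i → ∀ j → f i ≤ f j
  argmin {zero}  f = zero , λ { zero → ≤-refl }
  argmin {suc n} f with argmin (f ∘ suc)
  ... | i , fi≤f with total (f zero) (f (suc i))
  ...   | inj₁ f0≤fi = zero  , λ { zero → ≤-refl ; (suc j) → ≤-trans f0≤fi (fi≤f j) }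
  ...   | inj₂ fi≤f0 = suc i , λ { zero → fi≤f0  ; (suc j) → fi≤f j }

-- Limits, and the monotone sequence that defines exp.

module Exponential (em : ExcludedMiddle 0ℓ) (ℝ : CompleteOrderedField) where

  open MarkovChains em ℝ hiding (zero)
  open OrderedField em ℝ
  open ≤-Reasoning

  0≤fromℕ : ∀ n → 0# ≤ fromℕ n
  0≤fromℕ zero    = ≤-refl
  0≤fromℕ (suc n) = ≤-respˡ (+-identityˡ 0#) (+-mono-≤ 0≤1 (0≤fromℕ n))

  0<fromℕ : ∀ n → 0# < fromℕ (suc n)
  0<fromℕ n = <-≤-trans 0<1 (≤-respˡ (+-identityʳ 1#) (+-mono-≤ ≤-refl (0≤fromℕ n)))

  fromℕ-suc≉0 : ∀ n → fromℕ (suc n) ≉ 0#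
  fromℕ-suc≉0 n = proj₂ (0<fromℕ n) ∘ sym

  x-ε<x : ∀ {x ε} → 0# < ε → x - ε < x
  x-ε<x {x} {ε} 0<ε@(0≤ε , _) =
    0≤y-x⇒x≤y (≤-respʳ (sym (x-[x-y]≈y x ε)) 0≤ε) ,
    λ x-ε≈x → proj₂ 0<ε (trans (sym (-‿inverseʳ x)) (trans (+-congˡ (-‿cong (sym x-ε≈x))) (x-[x-y]≈y x ε)))

  x<x+ε : ∀ {x ε} → 0# < ε → x < x + ε
  x<x+ε {x} {ε} 0<ε = <-respˡ (x+y-y≈x ε x) (x-ε<x 0<ε)
    where
    <-respˡ : ∀ {x y z} → x ≈ y → x < z → y < z
    <-respˡ x≈y = ≤-<-trans (≤-reflexive (sym x≈y))

  -- Since `lim` takes the value 0# on divergent sequences, a lower bound for `exp` requires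
  -- convergence first. Monotonicity is asked only from K on, because for negative x the early bases
  -- 1 + x/n can be negative.
  mono⇒convergent : ∀ (s : ℕ → Carrier) K → (∀ n → K ℕ.≤ n → s n ≤ s (suc n)) →
                    ∀ {b} → (∀ n → K ℕ.≤ n → s n ≤ b) → ∃ (s ⟶_)
  mono⇒convergent s K step {b} s≤b = l , s⟶l
    where
    S : Carrier → Set
    S x = ∃ λ n → K ℕ.≤ n × s n ≈ x

    supremum : ∃ (IsSupremum S)
    supremum = complete S (s K , K , ℕ.≤-refl , refl) (b , λ (n , K≤n , sn≈x) → ≤-respˡ sn≈x (s≤b n K≤n))

    l = proj₁ supremum

    s≤l : ∀ n → K ℕ.≤ n → s n ≤ l
    s≤l n K≤n = proj₁ (proj₂ supremum) (n , K≤n , refl)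

    mono : ∀ {M} → K ℕ.≤ M → ∀ {N} → M ℕ.≤′ N → s M ≤ s N
    mono K≤M ℕ.≤′-refl         = ≤-refl
    mono K≤M (ℕ.≤′-step M≤′N) = ≤-trans (mono K≤M M≤′N) (step _ (ℕ.≤-trans K≤M (ℕ.≤′⇒≤ M≤′N)))

    s⟶l : s ⟶ l
    s⟶l ε 0<ε with em {∃ λ N → K ℕ.≤ N × l - ε < s N}
    ... | yes (N , K≤N , l-ε<sN) = N , λ n N≤n →
      <-≤-trans l-ε<sN (mono K≤N (ℕ.≤⇒≤′ N≤n)) , ≤-<-trans (s≤l n (ℕ.≤-trans K≤N N≤n)) (x<x+ε 0<ε)
    ... | no none = contradiction
      (proj₂ (proj₂ supremum) λ (n , K≤n , sn≈x) → ≤-respˡ sn≈x (≮⇒≥ λ l-ε<sn → none (n , K≤n , l-ε<sn)))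
      (<⇒≱ (x-ε<x 0<ε))

  limit-≥ : ∀ {s l} → s ⟶ l → ∀ K {c} → (∀ n → K ℕ.≤ n → c ≤ s n) → c ≤ l
  limit-≥ {s} {l} s⟶l K {c} c≤s = ≮⇒≥ λ l<c →
    let N , close = s⟶l (c - l) (x≤y⇒0≤y-x (proj₁ l<c) , λ 0≈c-l →
                      proj₂ l<c (trans (sym (+-identityˡ l)) (trans (+-congʳ 0≈c-l) (x-y+y≈x l c))))
        s<c = proj₂ (close (N ℕ.⊔ K) (ℕ.m≤m⊔n N K))
    in <⇒≱ (<-≤-trans s<c (≤-reflexive (trans (+-comm l _) (x-y+y≈x l c)))) (c≤s _ (ℕ.m≤n⊔m N K))

  limit-≤ : ∀ {s l} → s ⟶ l → ∀ K {c} → (∀ n → K ℕ.≤ n → s n ≤ c) → l ≤ c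
  limit-≤ {s} {l} s⟶l K {c} s≤c = ≮⇒≥ λ c<l →
    let N , close = s⟶l (l - c) (x≤y⇒0≤y-x (proj₁ c<l) , λ 0≈l-c →
                      proj₂ c<l (trans (sym (+-identityˡ c)) (trans (+-congʳ 0≈l-c) (x-y+y≈x c l))))
        c<s = proj₁ (close (N ℕ.⊔ K) (ℕ.m≤m⊔n N K))
    in <⇒≱ (≤-<-trans (≤-reflexive (sym (x-[x-y]≈y l c))) c<s) (s≤c _ (ℕ.m≤n⊔m N K))

  -- `lim` selects its own limit by excluded middle. The hypothesis rules out the default branch,
  -- and `limit-≥` applies to whichever limit was selected.
  lim-≥ : ∀ {s} → ∃ (s ⟶_) → ∀ K {c} → (∀ n → K ℕ.≤ n → c ≤ s n) → c ≤ lim s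
  lim-≥ {s} convergent K c≤s with em {∃ (s ⟶_)}
  ... | yes (l , s⟶l) = limit-≥ s⟶l K c≤s
  ... | no divergent  = contradiction convergent divergent

  -- These are the first two terms of the binomial expansion, written homogeneously so that a = 0 is
  -- allowed. In the induction step, the product of a + d with the previous bound exceeds the new
  -- one by `M * (d * d) * a ^ m`, which is non-negative.
  bernoulli : ∀ {a d} → 0# ≤ a → 0# ≤ d → ∀ m →
              a ^ suc m + fromℕ (suc m) * d * a ^ m ≤ (a + d) ^ suc m
  bernoulli {a} {d} 0≤a 0≤d zero = ≤-reflexive
    (solve 2 (λ a d → a :* con 1 :+ (con 1 :+ con 0) :* d :* con 1 := (a :+ d) :* con 1) refl a d)
    where open Solver
  bernoulli {a} {d} 0≤a 0≤d (suc m) = begin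
    a * a^ + (1# + M) * d * a^
      ≈⟨ +-identityʳ _ ⟨
    a * a^ + (1# + M) * d * a^ + 0#
      ≤⟨ +-mono-≤ ≤-refl (*-nonNeg (*-nonNeg (0≤fromℕ (suc m)) (*-nonNeg 0≤d 0≤d)) (^-nonNeg 0≤a m)) ⟩
    a * a^ + (1# + M) * d * a^ + M * (d * d) * a ^ m
      ≈⟨ solve 4 (λ a d M p → a :* (a :* p) :+ (con 1 :+ M) :* d :* (a :* p) :+ M :* (d :* d) :* p
                           := (a :+ d) :* (a :* p :+ M :* d :* p)) refl a d M (a ^ m) ⟩
    (a + d) * (a^ + M * d * a ^ m)
      ≤⟨ *-monoˡ-≤ (≤-respˡ (+-identityˡ 0#) (+-mono-≤ 0≤a 0≤d)) (bernoulli 0≤a 0≤d m) ⟩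
    (a + d) * (a + d) ^ suc m ∎
    where
    open Solver
    a^ = a ^ suc m
    M  = fromℕ (suc m)

  expBase : Carrier → ℕ → Carrier
  expBase x n = 1# + x * fromℕ (suc n) ⁻¹

  module _ {x : Carrier} (x≤0 : x ≤ 0#) where

    expBase-step : ∀ n → expBase x n ≤ expBase x (suc n)
    expBase-step n = +-mono-≤ ≤-refl (begin
      x * N ⁻¹        ≈⟨ -x*y≈x*-y ⟨
      - (- x * N ⁻¹)  ≤⟨ neg-antitone (*-monoˡ-≤ (x≤0⇒0≤-x x≤0) (⁻¹-antitone (0<fromℕ n) N≤1+N)) ⟩
      - (- x * (1# + N) ⁻¹) ≈⟨ -x*y≈x*-y ⟩
      x * (1# + N) ⁻¹ ∎)
      where
      N = fromℕ (suc n)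
      N≤1+N : N ≤ 1# + N
      N≤1+N = ≤-respˡ (+-identityˡ N) (+-mono-≤ 0≤1 ≤-refl)
      -x*y≈x*-y : ∀ {y} → - (- x * y) ≈ x * y
      -x*y≈x*-y {y} = trans (-‿distribˡ-* (- x) y) (*-congʳ (-‿involutive x))

    expBase-mono : ∀ {m n} → m ℕ.≤′ n → expBase x m ≤ expBase x n
    expBase-mono ℕ.≤′-refl             = ≤-refl
    expBase-mono (ℕ.≤′-step {n} m≤′n) = ≤-trans (expBase-mono m≤′n) (expBase-step n)

    expBase≤1 : ∀ n → expBase x n ≤ 1#
    expBase≤1 n = begin
      1# + x * fromℕ (suc n) ⁻¹  ≤⟨ +-mono-≤ ≤-refl (*-monoʳ-≤ (0<x⇒0≤x⁻¹ (0<fromℕ n)) x≤0) ⟩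
      1# + 0# * fromℕ (suc n) ⁻¹ ≈⟨ +-congˡ (zeroˡ _) ⟩
      1# + 0#                    ≈⟨ +-identityʳ 1# ⟩
      1#                         ∎

    -- Scaling gives N * a = N + x and (1 + N) * b = (1 + N) + x for the two consecutive bases;
    -- subtracting, a + (1 + N) * d = 1. Multiplying `a ^ suc n` by this 1 produces precisely the
    -- two terms that `bernoulli` bounds by `b ^ suc (suc n)`.
    expTerm-step : ∀ n → 0# ≤ expBase x n → expBase x n ^ suc n ≤ expBase x (suc n) ^ suc (suc n)
    expTerm-step n 0≤a = begin
      a ^ suc n                                     ≈⟨ *-identityˡ _ ⟨
      1# * a ^ suc n                                ≈⟨ *-congʳ a+Md≈1 ⟨
      (a + (1# + N) * d) * a ^ suc n                ≈⟨ distribʳ _ a _ ⟩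
      a ^ suc (suc n) + (1# + N) * d * a ^ suc n    ≤⟨ bernoulli 0≤a (x≤y⇒0≤y-x (expBase-step n)) (suc n) ⟩
      (a + d) ^ suc (suc n)                         ≤⟨ ^-mono 0≤a+d (≤-reflexive a+d≈b) (suc (suc n)) ⟩
      b ^ suc (suc n)                               ∎
      where
      open Solver
      N = fromℕ (suc n)
      a = expBase x n
      b = expBase x (suc n)
      d = b - a

      a+d≈b : a + d ≈ b
      a+d≈b = trans (+-comm a d) (x-y+y≈x a b)

      0≤a+d : 0# ≤ a + d
      0≤a+d = ≤-respʳ (sym a+d≈b) (≤-trans 0≤a (expBase-step n))

      scale : ∀ m → fromℕ (suc m) * expBase x m ≈ fromℕ (suc m) + x
      scale m = begin-equality
        M * (1# + x * M ⁻¹) ≈⟨ solve 3 (λ M x i → M :* (con 1 :+ x :* i) := M :+ x :* (i :* M)) refl M x (M ⁻¹) ⟩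
        M + x * (M ⁻¹ * M)  ≈⟨ +-congˡ (trans (*-congˡ (⁻¹-inverse (fromℕ-suc≉0 m))) (*-identityʳ x)) ⟩
        M + x               ∎
        where M = fromℕ (suc m)

      a+Md≈1 : a + (1# + N) * d ≈ 1#
      a+Md≈1 = antisym (+-cancelʳ-≤ (N + x) (≤-reflexive eq)) (+-cancelʳ-≤ (N + x) (≤-reflexive (sym eq)))
        where
        -- Adding N + x, in the form N * a, completes the left side to (1 + N) * (a + d).
        eq : a + (1# + N) * d + (N + x) ≈ 1# + (N + x)
        eq = begin-equality
          a + (1# + N) * d + (N + x) ≈⟨ +-congˡ (scale n) ⟨
          a + (1# + N) * d + N * a   ≈⟨ solve 3 (λ a d N → a :+ (con 1 :+ N) :* d :+ N :* a
                                                        := (con 1 :+ N) :* (a :+ d)) refl a d N ⟩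
          (1# + N) * (a + d)         ≈⟨ *-congˡ a+d≈b ⟩
          (1# + N) * b               ≈⟨ scale (suc n) ⟩
          (1# + N) + x               ≈⟨ +-assoc 1# N x ⟩
          1# + (N + x)               ∎

    expTerm≤exp : ∀ K → 0# ≤ expBase x K → expBase x K ^ suc K ≤ exp x
    expTerm≤exp K 0≤eK = lim-≥ (mono⇒convergent s K step {1#} s≤1) K (λ n K≤n → mono (ℕ.≤⇒≤′ K≤n))
      where
      s : ℕ → Carrier
      s n = expBase x n ^ suc n

      0≤e : ∀ n → K ℕ.≤ n → 0# ≤ expBase x n
      0≤e n K≤n = ≤-trans 0≤eK (expBase-mono (ℕ.≤⇒≤′ K≤n))

      step : ∀ n → K ℕ.≤ n → s n ≤ s (suc n)
      step n K≤n = expTerm-step n (0≤e n K≤n)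

      s≤1 : ∀ n → K ℕ.≤ n → s n ≤ 1#
      s≤1 n K≤n = ≤-respʳ (1^n≈1 (suc n)) (^-mono (0≤e n K≤n) (expBase≤1 n) (suc n))

      mono : ∀ {n} → K ℕ.≤′ n → s K ≤ s n
      mono ℕ.≤′-refl        = ≤-refl
      mono (ℕ.≤′-step K≤n) = ≤-trans (mono K≤n) (step _ (ℕ.≤′⇒≤ K≤n))

  [1-r]^T≤exp : ∀ {r} → 0# ≤ r → r ≤ 1# → ∀ T → (1# - r) ^ T ≤ exp (- (fromℕ T * r))
  -- No term of the sequence has exponent 0. Here x is 0, and the term of index 0 already equals 1.
  [1-r]^T≤exp {r} 0≤r r≤1 zero = begin
    1#             ≈⟨ 1^n≈1 1 ⟨
    1# ^ 1         ≤⟨ ^-mono 0≤1 (≤-reflexive (sym base≈1)) 1 ⟩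
    expBase x 0 ^ 1 ≤⟨ expTerm≤exp (≤-reflexive x≈0) 0 (≤-respʳ (sym base≈1) 0≤1) ⟩
    exp x          ∎
    where
    x = - (fromℕ 0 * r)
    x≈0 : x ≈ 0#
    x≈0 = trans (-‿cong (zeroˡ r)) -0#≈0#
    base≈1 : expBase x 0 ≈ 1#
    base≈1 = trans (+-congˡ (trans (*-congʳ x≈0) (zeroˡ _))) (+-identityʳ 1#)
  [1-r]^T≤exp {r} 0≤r r≤1 (suc K) = begin
    (1# - r) ^ suc K      ≤⟨ ^-mono (x≤y⇒0≤y-x r≤1) (≤-reflexive (sym base≈1-r)) (suc K) ⟩
    expBase x K ^ suc K   ≤⟨ expTerm≤exp x≤0 K (≤-respʳ (sym base≈1-r) (x≤y⇒0≤y-x r≤1)) ⟩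
    exp x                 ∎
    where
    M = fromℕ (suc K)
    x = - (M * r)
    x≤0 : x ≤ 0#
    x≤0 = ≤-respʳ -0#≈0# (neg-antitone (*-nonNeg (0≤fromℕ (suc K)) 0≤r))
    base≈1-r : expBase x K ≈ 1# - r
    base≈1-r = +-congˡ (begin-equality
      - (M * r) * M ⁻¹   ≈⟨ -‿distribˡ-* (M * r) (M ⁻¹) ⟨
      - (M * r * M ⁻¹)   ≈⟨ -‿cong (*-congʳ (*-comm M r)) ⟩
      - (r * M * M ⁻¹)   ≈⟨ -‿cong (x*z*z⁻¹≈x r (fromℕ-suc≉0 K)) ⟩
      - r                ∎)

-- Hitting times, and the test function they provide.

module HittingTimes (em : ExcludedMiddle 0ℓ) (ℝ : CompleteOrderedField) where

  open MarkovChains em ℝ hiding (zero)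
  open OrderedField em ℝ
  open Exponential em ℝ using (0≤fromℕ)
  open ≤-Reasoning

  -- A value `fin s` can come only from the bounded branch of `⨆`; matching on the equation exposes
  -- the supremum that `complete` returned there.
  ⨆-fin : ∀ {I : Set} {f : I → Extended} {s} → ⨆ f ≡ fin s → BoundedBy f s × (∀ {b} → BoundedBy f b → s ≤ b)
  ⨆-fin {f = f} ⨆f≡s with em {∃ (BoundedBy f)}
  ⨆-fin {f = f} ≡.refl | yes (b , f≤b)
    with complete (Values f) (0# , inj₁ refl) (b , values-bounded f≤b)
  ... | s , upper , least =
    (upper (inj₁ refl) , λ i → let x , fi≡x , _ = proj₂ f≤b i in x , fi≡x , upper (inj₂ (i , fi≡x))) ,
    λ f≤b′ → least (values-bounded f≤b′)

  indicator-true : ∀ {A} → A → indicator A ≈ 1#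
  indicator-true {A} a with em {A}
  ... | yes _ = refl
  ... | no ¬a = contradiction a ¬a

  indicator-false : ∀ {A} → ¬ A → indicator A ≈ 0#
  indicator-false {A} ¬a with em {A}
  ... | yes a = contradiction a ¬a
  ... | no _  = refl

  indicator-cong : ∀ {A B} → (A → B) → (B → A) → indicator A ≈ indicator B
  indicator-cong {A} {B} to from with em {B}
  ... | yes b = indicator-true (from b)
  ... | no ¬b = indicator-false (¬b ∘ to)

  indicator-nonNeg : ∀ A → 0# ≤ indicator A
  indicator-nonNeg A with em {A}
  ... | yes _ = 0≤1
  ... | no _  = ≤-refl

  indicator≤1 : ∀ A → indicator A ≤ 1#
  indicator≤1 A with em {A}
  ... | yes _ = ≤-refl
  ... | no _  = 0≤1

  sumVec-cong : ∀ {n} t {f g : Vec (Fin n) t → Carrier} → (∀ ys → f ys ≈ g ys) → sumVec t f ≈ sumVec t g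
  sumVec-cong zero    f≈g = f≈g []
  sumVec-cong (suc t) f≈g = sum-cong-≋ λ v → sumVec-cong t λ ys → f≈g (v ∷ ys)

  *-distribˡ-sumVec : ∀ {n} t c (f : Vec (Fin n) t → Carrier) → c * sumVec t f ≈ sumVec t (λ ys → c * f ys)
  *-distribˡ-sumVec zero    c f = refl
  *-distribˡ-sumVec (suc t) c f =
    trans (*-distribˡ-sum c λ v → sumVec t λ ys → f (v ∷ ys)) (sum-cong-≋ λ v → *-distribˡ-sumVec t c λ ys → f (v ∷ ys))

  sumVec-zero : ∀ {n} t {f : Vec (Fin n) t → Carrier} → (∀ ys → f ys ≈ 0#) → sumVec t f ≈ 0#
  sumVec-zero zero    f≈0 = f≈0 []
  sumVec-zero (suc t) f≈0 = sum-zero λ v → sumVec-zero t λ ys → f≈0 (v ∷ ys)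

  sumVec-nonNeg : ∀ {n} t {f : Vec (Fin n) t → Carrier} → (∀ ys → 0# ≤ f ys) → 0# ≤ sumVec t f
  sumVec-nonNeg zero    0≤f = 0≤f []
  sumVec-nonNeg (suc t) 0≤f = sum-nonNeg λ v → sumVec-nonNeg t λ ys → 0≤f (v ∷ ys)

  _⊙_ : ∀ {n} → Matrix n → (Fin n → Carrier) → Fin n → Carrier
  (A ⊙ f) u = sum (λ v → A u v * f v)

  ⊙-1 : ∀ {n} (A : Matrix n) u → (A ⊙ λ _ → 1#) u ≈ sum (A u)
  ⊙-1 A u = sum-cong-≋ λ v → *-identityʳ (A u v)

  ⊙-assoc : ∀ {n} (A B : Matrix n) f u → ((A ⊗ B) ⊙ f) u ≈ (A ⊙ (B ⊙ f)) u
  ⊙-assoc A B f u = begin-equality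
    sum (λ v → sum (λ x → A u x * B x v) * f v)
      ≈⟨ sum-cong-≋ (λ v → trans (*-distribʳ-sum (f v) λ x → A u x * B x v) (sum-cong-≋ λ x → *-assoc (A u x) (B x v) (f v))) ⟩
    sum (λ v → sum (λ x → A u x * (B x v * f v)))
      ≈⟨ ∑-comm (λ v x → A u x * (B x v * f v)) ⟩
    sum (λ x → sum (λ v → A u x * (B x v * f v)))
      ≈⟨ sum-cong-≋ (λ x → *-distribˡ-sum (A u x) λ v → B x v * f v) ⟨
    sum (λ x → A u x * sum (λ v → B x v * f v)) ∎

  power-⊙-zero : ∀ {n} (P : Matrix n) f u → (power P 0 ⊙ f) u ≈ f u
  power-⊙-zero P f u = begin-equality
    (power P 0 ⊙ f) u         ≈⟨ sum-single u (λ v u≢v → trans (*-congʳ (indicator-false u≢v)) (zeroˡ (f v))) ⟩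
    indicator (u ≡ u) * f u   ≈⟨ *-congʳ (indicator-true ≡.refl) ⟩
    1# * f u                  ≈⟨ *-identityˡ (f u) ⟩
    f u                       ∎

  module _ {n} {P : Matrix n} (transition : IsTransition P) where

    open IsTransition transition

    ⊙-mono : ∀ {f g} → (∀ v → f v ≤ g v) → ∀ u → (P ⊙ f) u ≤ (P ⊙ g) u
    ⊙-mono f≤g u = sum-mono λ v → *-monoˡ-≤ (nonNeg u v) (f≤g v)

    ⊙-1≈1 : ∀ u → (P ⊙ λ _ → 1#) u ≈ 1#
    ⊙-1≈1 u = trans (⊙-1 P u) (stochastic u)

    power-nonNeg : ∀ t u v → 0# ≤ power P t u v
    power-nonNeg zero    u v = indicator-nonNeg (u ≡ v)
    power-nonNeg (suc t) u v = sum-nonNeg λ x → *-nonNeg (nonNeg u x) (power-nonNeg t x v)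

    power-⊙-1 : ∀ t u → (power P t ⊙ λ _ → 1#) u ≈ 1#
    power-⊙-1 zero    u = power-⊙-zero P (λ _ → 1#) u
    power-⊙-1 (suc t) u = begin-equality
      (power P (suc t) ⊙ λ _ → 1#) u     ≈⟨ ⊙-assoc P (power P t) (λ _ → 1#) u ⟩
      (P ⊙ (power P t ⊙ λ _ → 1#)) u     ≈⟨ sum-cong-≋ (λ v → *-congˡ (power-⊙-1 t v)) ⟩
      (P ⊙ λ _ → 1#) u                   ≈⟨ ⊙-1≈1 u ⟩
      1#                                 ∎

    power-superharmonic : ∀ {s} → (∀ u → (P ⊙ s) u ≤ s u) → ∀ t u → (power P t ⊙ s) u ≤ s u
    power-superharmonic {s} Ps≤s zero    u = ≤-reflexive (power-⊙-zero P s u)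
    power-superharmonic {s} Ps≤s (suc t) u = begin
      (power P (suc t) ⊙ s) u     ≈⟨ ⊙-assoc P (power P t) s u ⟩
      (P ⊙ (power P t ⊙ s)) u     ≤⟨ ⊙-mono (power-superharmonic Ps≤s t) u ⟩
      (P ⊙ s) u                   ≤⟨ Ps≤s u ⟩
      s u                         ∎

  -- At a minimiser `m` of s, the t-step average of the non-negative function `e` is at most 0.
  -- Irreducibility chooses t so that `w` has positive weight in this average, which forces e w ≤ 0;
  -- hence `w` is a minimiser too.
  minimum-principle : ∀ {n} {P : Matrix n} → IsTransition P → Irreducible P →
                      ∀ {s} → (∀ u → (P ⊙ s) u ≤ s u) → ∀ w u → s w ≤ s u
  minimum-principle {suc n} {P} transition irreducible {s} Ps≤s w u = ≤-trans sw≤sm (m-min u)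
    where
    m     = proj₁ (argmin s)
    m-min = proj₂ (argmin s)
    t     = proj₁ (irreducible m w)
    Q     = power P t
    0<Qmw = proj₂ (proj₂ (irreducible m w))

    e : Fin (suc n) → Carrier
    e v = s v - s m

    0≤e : ∀ v → 0# ≤ e v
    0≤e v = x≤y⇒0≤y-x (m-min v)

    Qe≤0 : (Q ⊙ e) m ≤ 0#
    Qe≤0 = +-cancelʳ-≤ (s m) (begin
      (Q ⊙ e) m + s m
        ≈⟨ +-congˡ (trans (*-congʳ (power-⊙-1 transition t m)) (*-identityˡ (s m))) ⟨
      (Q ⊙ e) m + (Q ⊙ λ _ → 1#) m * s m
        ≈⟨ +-congˡ (trans (*-distribʳ-sum (s m) λ v → Q m v * 1#) (sum-cong-≋ λ v → *-congʳ {s m} (*-identityʳ (Q m v)))) ⟩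
      (Q ⊙ e) m + sum (λ v → Q m v * s m)
        ≈⟨ ∑-distrib-+ (λ v → Q m v * e v) (λ v → Q m v * s m) ⟨
      sum (λ v → Q m v * e v + Q m v * s m)
        ≈⟨ sum-cong-≋ (λ v → trans (sym (distribˡ (Q m v) (e v) (s m))) (*-congˡ (x-y+y≈x (s m) (s v)))) ⟩
      (Q ⊙ s) m ≤⟨ power-superharmonic transition Ps≤s t m ⟩
      s m       ≈⟨ +-identityˡ (s m) ⟨
      0# + s m  ∎)

    sw≤sm : s w ≤ s m
    sw≤sm = ≤-respˡ (x-y+y≈x (s m) (s w)) (≤-respʳ (+-identityˡ (s m)) (+-monoˡ-≤ (s m)
      (*-cancelʳ-≤ 0<Qmw (begin
        e w * Q m w  ≈⟨ *-comm (e w) (Q m w) ⟩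
        Q m w * e w  ≤⟨ term≤sum (λ v → *-nonNeg (power-nonNeg transition t m v) (0≤e v)) w ⟩
        (Q ⊙ e) m    ≤⟨ Qe≤0 ⟩
        0#           ≈⟨ zeroˡ (Q m w) ⟨
        0# * Q m w   ∎))))

  module _ {n} {P : Matrix n} (transition : IsTransition P) (w : Fin n) where

    open IsTransition transition

    pathProb-nonNeg : ∀ {t} u (ys : Vec (Fin n) t) → 0# ≤ pathProb P u ys
    pathProb-nonNeg u []       = 0≤1
    pathProb-nonNeg u (y ∷ ys) = *-nonNeg (nonNeg u y) (pathProb-nonNeg y ys)

    hitProb-nonNeg : ∀ u t → 0# ≤ hitProb P u w t
    hitProb-nonNeg u t = sumVec-nonNeg t λ ys →
      *-nonNeg (indicator-nonNeg (FirstHit w (u ∷ ys))) (pathProb-nonNeg u ys)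

    hitProb-target-zero : hitProb P w w 0 ≈ 1#
    hitProb-target-zero = trans (*-identityʳ _) (indicator-true ((λ ()) , ≡.refl))

    hitProb-target-suc : ∀ t → hitProb P w w (suc t) ≈ 0#
    hitProb-target-suc t = sumVec-zero {n} (suc t) λ ys →
      trans (*-congʳ {pathProb P w ys} (indicator-false {FirstHit w (w ∷ ys)} λ (avoids , _) → avoids zero ≡.refl))
            (zeroˡ (pathProb P w ys))

    hitProb-zero : ∀ {u} → u ≢ w → hitProb P u w 0 ≈ 0#
    hitProb-zero u≢w = trans (*-identityʳ _) (indicator-false (u≢w ∘ proj₂))

    -- Decomposition over the first step: putting a vertex other than `w` in front of a trajectory
    -- delays its first hit by exactly one.
    hitProb-suc : ∀ {u} → u ≢ w → ∀ t → hitProb P u w (suc t) ≈ (P ⊙ λ v → hitProb P v w t) u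
    hitProb-suc {u} u≢w t = sum-cong-≋ λ v → begin-equality
      sumVec t (λ ys → indicator (FirstHit w (u ∷ v ∷ ys)) * (P u v * pathProb P v ys))
        ≈⟨ sumVec-cong t (λ ys → trans (*-congʳ (firstHit-step v ys))
             (solve 3 (λ i p q → i :* (p :* q) := p :* (i :* q)) refl (indicator (FirstHit w (v ∷ ys))) (P u v) (pathProb P v ys))) ⟩
      sumVec t (λ ys → P u v * (indicator (FirstHit w (v ∷ ys)) * pathProb P v ys))
        ≈⟨ *-distribˡ-sumVec t (P u v) _ ⟨
      P u v * hitProb P v w t ∎
      where
      open Solver using (solve; _:*_; _:=_)
      firstHit-step : ∀ v (ys : Vec (Fin n) t) → indicator (FirstHit w (u ∷ v ∷ ys)) ≈ indicator (FirstHit w (v ∷ ys))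
      firstHit-step v ys = indicator-cong
        (λ (avoids , hits) → avoids ∘ suc , hits)
        (λ (avoids , hits) → (λ { zero → u≢w ; (suc s) → avoids s }) , hits)

    -- With τ the hitting time of `w` from u, this is Pr[τ < N], and `expectedHitBefore` is
    -- E[τ; τ < N]. Truncation makes the first-step equations identities between finite sums.
    hitBefore : Fin n → ℕ → Carrier
    hitBefore u N = sum {N} (λ t → hitProb P u w (toℕ t))

    expectedHitBefore : Fin n → ℕ → Carrier
    expectedHitBefore u N = sum {N} (λ t → fromℕ (toℕ t) * hitProb P u w (toℕ t))

    hitBefore-mono : ∀ u → Monotone (hitBefore u)
    hitBefore-mono u = sum-mono-length (hitProb-nonNeg u)

    expectedHitBefore-mono : ∀ u → Monotone (expectedHitBefore u)
    expectedHitBefore-mono u = sum-mono-length λ t → *-nonNeg (0≤fromℕ t) (hitProb-nonNeg u t)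

    hitBefore-target : ∀ N → hitBefore w (suc N) ≈ 1#
    hitBefore-target N = trans (+-cong hitProb-target-zero (sum-zero {N} (hitProb-target-suc ∘ toℕ))) (+-identityʳ 1#)

    hitBefore-suc : ∀ {u} → u ≢ w → ∀ N → hitBefore u (suc N) ≈ (P ⊙ λ v → hitBefore v N) u
    hitBefore-suc {u} u≢w N = begin-equality
      hitProb P u w 0 + sum {N} (λ t → hitProb P u w (suc (toℕ t)))
        ≈⟨ +-cong (hitProb-zero u≢w) (sum-cong-≋ {N} (hitProb-suc u≢w ∘ toℕ)) ⟩
      0# + sum {N} (λ t → sum (λ v → P u v * hitProb P v w (toℕ t)))
        ≈⟨ +-identityˡ _ ⟩
      sum {N} (λ t → sum (λ v → P u v * hitProb P v w (toℕ t)))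
        ≈⟨ ∑-comm {N} {n} (λ t v → P u v * hitProb P v w (toℕ t)) ⟩
      sum (λ v → sum {N} (λ t → P u v * hitProb P v w (toℕ t)))
        ≈⟨ sum-cong-≋ (λ v → *-distribˡ-sum {N} (P u v) (λ t → hitProb P v w (toℕ t))) ⟨
      sum (λ v → P u v * hitBefore v N) ∎

    -- Off `w`, τ is 1 plus the hitting time from the next vertex. The summand `hitBefore v N` is
    -- the contribution of that 1.
    expectedHitBefore-suc : ∀ {u} → u ≢ w → ∀ N →
      expectedHitBefore u (suc N) ≈ (P ⊙ λ v → expectedHitBefore v N + hitBefore v N) u
    expectedHitBefore-suc {u} u≢w N = begin-equality
      0# * hitProb P u w 0 + sum {N} (λ t → (1# + fromℕ (toℕ t)) * hitProb P u w (suc (toℕ t)))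
        ≈⟨ +-cong (zeroˡ _) (sum-cong-≋ {N} λ t →
             trans (*-congˡ (hitProb-suc u≢w (toℕ t))) (*-distribˡ-sum (1# + fromℕ (toℕ t)) λ v → P u v * hitProb P v w (toℕ t))) ⟩
      0# + sum {N} (λ t → sum (λ v → (1# + fromℕ (toℕ t)) * (P u v * hitProb P v w (toℕ t))))
        ≈⟨ +-identityˡ _ ⟩
      sum {N} (λ t → sum (λ v → (1# + fromℕ (toℕ t)) * (P u v * hitProb P v w (toℕ t))))
        ≈⟨ ∑-comm {N} {n} (λ t v → (1# + fromℕ (toℕ t)) * (P u v * hitProb P v w (toℕ t))) ⟩
      sum (λ v → sum {N} (λ t → (1# + fromℕ (toℕ t)) * (P u v * hitProb P v w (toℕ t))))
        ≈⟨ sum-cong-≋ (λ v → sum-cong-≋ {N} λ t →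
             solve 3 (λ N p a → (con 1 :+ N) :* (p :* a) := p :* (N :* a :+ a)) refl (fromℕ (toℕ t)) (P u v) (hitProb P v w (toℕ t))) ⟩
      sum (λ v → sum {N} (λ t → P u v * (fromℕ (toℕ t) * hitProb P v w (toℕ t) + hitProb P v w (toℕ t))))
        ≈⟨ sum-cong-≋ (λ v → trans (*-congˡ (sym (∑-distrib-+ {N} _ _))) (*-distribˡ-sum {N} (P u v) _)) ⟨
      sum (λ v → P u v * (expectedHitBefore v N + hitBefore v N)) ∎
      where open Solver

    hitBefore≤1 : ∀ N u → hitBefore u N ≤ 1#
    hitBefore≤1 zero    u = 0≤1
    hitBefore≤1 (suc N) u with em {u ≡ w}
    ... | yes ≡.refl = ≤-reflexive (hitBefore-target N)
    ... | no u≢w = begin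
      hitBefore u (suc N)           ≈⟨ hitBefore-suc u≢w N ⟩
      (P ⊙ λ v → hitBefore v N) u   ≤⟨ ⊙-mono transition (hitBefore≤1 N) u ⟩
      (P ⊙ λ _ → 1#) u              ≈⟨ ⊙-1≈1 transition u ⟩
      1#                            ∎

    -- Here s is the probability of ever hitting `w`. It is superharmonic, so by the minimum
    -- principle no vertex has a smaller value than `w`, where the hit is immediate and s is at
    -- least 1.
    hitsEventually : Irreducible P → ∃ λ s → (∀ u → Least (hitBefore u) (s u)) × (∀ u → 1# ≤ s u)
    hitsEventually irreducible = s , least , λ u → ≤-trans 1≤sw (minimum-principle transition irreducible Ps≤s w u)
      where
      supremum : ∀ u → ∃ λ s → (∀ N → hitBefore u N ≤ s) × Least (hitBefore u) s
      supremum u = bounded⇒supremum (hitBefore u) λ N → hitBefore≤1 N u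

      s : Fin n → Carrier
      s u = proj₁ (supremum u)

      upper : ∀ u N → hitBefore u N ≤ s u
      upper u = proj₁ (proj₂ (supremum u))

      least : ∀ u → Least (hitBefore u) (s u)
      least u = proj₂ (proj₂ (supremum u))

      1≤sw : 1# ≤ s w
      1≤sw = ≤-respˡ (hitBefore-target 0) (upper w 1)

      Ps≤s : ∀ u → (P ⊙ s) u ≤ s u
      Ps≤s u with em {u ≡ w}
      -- The first-step equation fails at `w`, where time 0 already counts; there the average of s
      -- is at most 1, which is at most `s w`.
      ... | yes ≡.refl = begin
        (P ⊙ s) w          ≤⟨ ⊙-mono transition (λ v → least v λ N → hitBefore≤1 N v) w ⟩
        (P ⊙ λ _ → 1#) w   ≈⟨ ⊙-1≈1 transition w ⟩
        1#                 ≤⟨ 1≤sw ⟩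
        s w                ∎
      ... | no u≢w = sum-sup-≤ (P u) (nonNeg u) hitBefore hitBefore-mono s least λ N →
        ≤-respˡ (hitBefore-suc u≢w N) (upper u (suc N))

    -- The truncated first-step equation is bounded by h u at every level. Letting the truncation of
    -- the probabilities grow first turns their P-average into at least 1, by almost sure hitting;
    -- letting the truncation of the expectations grow afterwards gives P h.
    expectedHit-step : Irreducible P → ∀ {h} → (∀ u → expectedHit P u w ≡ fin (h u)) →
                       ∀ {u} → u ≢ w → 1# + (P ⊙ h) u ≤ h u
    expectedHit-step irreducible {h} h≡ {u} u≢w with hitsEventually irreducible
    ... | s , s-least , 1≤s = begin
      1# + (P ⊙ h) u       ≈⟨ +-comm 1# _ ⟩
      (P ⊙ h) u + 1#       ≤⟨ x≤z-y⇒x+y≤z (sum-sup-≤ (P u) (nonNeg u) expectedHitBefore expectedHitBefore-mono h h-least Ph≤h-1) ⟩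
      h u                  ∎
      where
      h-upper : ∀ v N → expectedHitBefore v N ≤ h v
      h-upper v N with proj₂ (proj₁ (⨆-fin (h≡ v))) N
      ... | _ , ≡.refl , p = p

      h-least : ∀ v → Least (expectedHitBefore v) (h v)
      -- `p 0` supplies the non-negativity that `BoundedBy` demands, because the empty sum is 0#.
      h-least v p = proj₂ (⨆-fin (h≡ v)) (p 0 , λ N → expectedHitBefore v N , ≡.refl , p N)

      -- Two independent truncation levels allow the two suprema to be taken one after the other.
      Ph+Pp≤h : ∀ N M → (P ⊙ λ v → expectedHitBefore v N) u + (P ⊙ λ v → hitBefore v M) u ≤ h u
      Ph+Pp≤h N M = begin
        (P ⊙ λ v → expectedHitBefore v N) u + (P ⊙ λ v → hitBefore v M) u
          ≤⟨ +-mono-≤ (⊙-mono transition (λ v → expectedHitBefore-mono v (ℕ.m≤m⊔n N M)) u)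
                      (⊙-mono transition (λ v → hitBefore-mono v (ℕ.m≤n⊔m N M)) u) ⟩
        (P ⊙ λ v → expectedHitBefore v K) u + (P ⊙ λ v → hitBefore v K) u
          ≈⟨ ∑-distrib-+ (λ v → P u v * expectedHitBefore v K) (λ v → P u v * hitBefore v K) ⟨
        sum (λ v → P u v * expectedHitBefore v K + P u v * hitBefore v K)
          ≈⟨ sum-cong-≋ (λ v → distribˡ (P u v) _ _) ⟨
        (P ⊙ λ v → expectedHitBefore v K + hitBefore v K) u
          ≈⟨ expectedHitBefore-suc u≢w K ⟨
        expectedHitBefore u (suc K)
          ≤⟨ h-upper u (suc K) ⟩
        h u ∎
        where K = N ℕ.⊔ M

      Ph≤h-1 : ∀ N → (P ⊙ λ v → expectedHitBefore v N) u ≤ h u - 1#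
      Ph≤h-1 N = x+y≤z⇒x≤z-y (begin
        (P ⊙ λ v → expectedHitBefore v N) u + 1#         ≈⟨ +-comm _ 1# ⟩
        1# + (P ⊙ λ v → expectedHitBefore v N) u         ≤⟨ +-monoˡ-≤ _ (≤-respˡ (⊙-1≈1 transition u) (⊙-mono transition 1≤s u)) ⟩
        (P ⊙ s) u + (P ⊙ λ v → expectedHitBefore v N) u
          ≤⟨ x≤z-y⇒x+y≤z (sum-sup-≤ (P u) (nonNeg u) hitBefore hitBefore-mono s s-least λ M →
               x+y≤z⇒x≤z-y (≤-respˡ (+-comm _ _) (Ph+Pp≤h N M))) ⟩
        h u ∎)

  -- The data of Schur's test: `h` is the test function and `c` the resulting norm bound for `P`
  -- with `w` deleted. In `contracted` the column of `w` is still present; as `h w` is non-negative,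
  -- the inequality also holds with that column deleted.
  record Decay {n} (P : Matrix n) (w : Fin n) (c : Carrier) : Set where
    field
      0≤c        : 0# ≤ c
      h          : Fin n → Carrier
      0≤h        : ∀ v → 0# ≤ h v
      0<h        : ∀ {v} → v ≢ w → 0# < h v
      contracted : ∀ {u} → u ≢ w → (P ⊙ h) u ≤ c * h u

  module _ {n} {P : Matrix n} (transition : IsTransition P) (irreducible : Irreducible P)
           {H} (tHit≡H : tHit P ≡ fin H) where

    tHit-bound : ∀ u w → ∃ λ x → expectedHit P u w ≡ fin x × x ≤ H
    tHit-bound u w = proj₂ (proj₁ (⨆-fin tHit≡H)) (u , w)

    module _ (w : Fin n) where

      hitTime : Fin n → Carrier
      hitTime u = proj₁ (tHit-bound u w)

      hitTime≡ : ∀ u → expectedHit P u w ≡ fin (hitTime u)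
      hitTime≡ u = proj₁ (proj₂ (tHit-bound u w))

      hitTime≤H : ∀ u → hitTime u ≤ H
      hitTime≤H u = proj₂ (proj₂ (tHit-bound u w))

      hitTime-nonNeg : ∀ u → 0# ≤ hitTime u
      hitTime-nonNeg u = proj₁ (proj₁ (⨆-fin (hitTime≡ u)))

      hitTime-step : ∀ {u} → u ≢ w → 1# + (P ⊙ hitTime) u ≤ hitTime u
      hitTime-step = expectedHit-step transition w irreducible hitTime≡

      1≤hitTime : ∀ {u} → u ≢ w → 1# ≤ hitTime u
      1≤hitTime {u} u≢w = ≤-trans (≤-respˡ (+-identityʳ 1#) (+-mono-≤ ≤-refl
        (sum-nonNeg λ v → *-nonNeg (IsTransition.nonNeg transition u v) (hitTime-nonNeg v)))) (hitTime-step u≢w)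

      1≤H : ∀ {u} → u ≢ w → 1# ≤ H
      1≤H {u} u≢w = ≤-trans (1≤hitTime u≢w) (hitTime≤H u)

      -- Since `hitTime` is at most H, the 1 gained in each step is at least the fraction `H ⁻¹` of
      -- `hitTime`. The second vertex `u₀` ensures 1 ≤ H, so that H is invertible and the factor is
      -- non-negative.
      hitTime-decay : ∀ {u} → u ≢ w → Decay P w (1# - H ⁻¹)
      hitTime-decay {u₀} u₀≢w = record
        { 0≤c        = x≤y⇒0≤y-x (≤-respʳ 1⁻¹≈1 (⁻¹-antitone 0<1 (1≤H u₀≢w)))
        ; h          = hitTime
        ; 0≤h        = hitTime-nonNeg
        ; 0<h        = λ v≢w → <-≤-trans 0<1 (1≤hitTime v≢w)
        ; contracted = λ {u} u≢w → begin
            (P ⊙ hitTime) u                         ≤⟨ x+y≤z⇒x≤z-y (≤-respˡ (+-comm 1# _) (hitTime-step u≢w)) ⟩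
            hitTime u - 1#                          ≈⟨ +-congˡ (-‿cong (⁻¹-inverse (proj₂ 0<H ∘ sym))) ⟨
            hitTime u - H ⁻¹ * H                    ≤⟨ +-mono-≤ ≤-refl (neg-antitone (*-monoˡ-≤ (0<x⇒0≤x⁻¹ 0<H) (hitTime≤H u))) ⟩
            hitTime u - H ⁻¹ * hitTime u            ≈⟨ +-congʳ (*-identityˡ (hitTime u)) ⟨
            1# * hitTime u - H ⁻¹ * hitTime u       ≈⟨ [y-z]x≈yx-zx (hitTime u) 1# (H ⁻¹) ⟨
            (1# - H ⁻¹) * hitTime u                 ∎
        }
        where
        0<H = <-≤-trans 0<1 (1≤H u₀≢w)

  otherVertex : ∀ {n} → 2 ℕ.≤ n → (w : Fin n) → ∃ λ u → u ≢ w
  otherVertex (ℕ.s≤s (ℕ.s≤s _)) zero    = suc zero , λ ()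
  otherVertex (ℕ.s≤s (ℕ.s≤s _)) (suc w) = zero , λ ()

  decay : ∀ {n} → 2 ℕ.≤ n → {P : Matrix n} → IsTransition P → Irreducible P →
          ∀ w → Decay P w (1# - recip (tHit P))
  decay 2≤n {P} transition irreducible w with tHit P in tHit≡
  ... | fin H = hitTime-decay transition irreducible tHit≡ w (proj₂ (otherVertex 2≤n w))
  -- With 1/∞ = 0 the factor is 1, and the constant function 1 is a test function because `P` is
  -- stochastic.
  ... | ∞     = record
    { 0≤c        = ≤-respʳ 1≈1-0 0≤1
    ; h          = λ _ → 1#
    ; 0≤h        = λ _ → 0≤1
    ; 0<h        = λ _ → 0<1
    ; contracted = λ {u} _ → ≤-reflexive (trans (⊙-1≈1 transition u) (trans 1≈1-0 (sym (*-identityʳ _))))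
    }
    where
    1≈1-0 : 1# ≈ 1# - 0#
    1≈1-0 = sym (trans (+-congˡ -0#≈0#) (+-identityʳ 1#))

-- Contraction in L²(π) and the decay of survival probabilities.

module Survival (em : ExcludedMiddle 0ℓ) (ℝ : CompleteOrderedField) where

  open MarkovChains em ℝ hiding (zero)
  open OrderedField em ℝ
  open HittingTimes em ℝ
  open ≤-Reasoning

  -- The probability of avoiding w at the times k , … , k + T, from u at time k.
  survival : ∀ {n} → (ℕ → Matrix n) → Fin n → ℕ → ℕ → Fin n → Carrier
  survival P w k zero    u = indicator (u ≢ w)
  survival P w k (suc T) u = indicator (u ≢ w) * (P k ⊙ survival P w (suc k) T) u

  normSq : ∀ {n} → (Fin n → Carrier) → (Fin n → Carrier) → Carrier
  normSq π f = sum (λ v → π v * (f v * f v))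

  -- Schur's test: Cauchy–Schwarz with the weights P u v * h v bounds g u * g u
  -- by c * h u * (P ⊙ (h * y * y)) u, where y = f / h; reversibility then moves P
  -- from h * y * y onto h.
  contraction : ∀ {n} {π : Fin n → Carrier} {P w c} → (∀ v → 0# ≤ π v) → (∀ u v → 0# ≤ P u v) →
                Reversible π P → Decay P w c → ∀ {f g} → f w ≈ 0# → g w ≈ 0# → (∀ {u} → u ≢ w → g u ≈ (P ⊙ f) u) →
                normSq π g ≤ (c * c) * normSq π f
  contraction {n} {π} {P} {w} {c} 0≤π 0≤P reversible decay {f} {g} fw≈0 gw≈0 g≈Pf = begin
    sum (λ u → π u * (g u * g u))
      ≤⟨ sum-mono (λ u → *-monoˡ-≤ (0≤π u) (g²≤ u)) ⟩
    sum (λ u → π u * (c * h u * (P ⊙ z) u))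
      ≈⟨ sum-cong-≋ (λ u → trans
           (solve 4 (λ p c h s → p :* (c :* h :* s) := c :* (p :* h) :* s) refl (π u) c (h u) ((P ⊙ z) u))
           (*-distribˡ-sum (c * (π u * h u)) λ v → P u v * z v)) ⟩
    sum (λ u → sum (λ v → c * (π u * h u) * (P u v * z v)))
      ≈⟨ ∑-comm (λ u v → c * (π u * h u) * (P u v * z v)) ⟩
    sum (λ v → sum (λ u → c * (π u * h u) * (P u v * z v)))
      ≈⟨ sum-cong-≋ (λ v → sum-cong-≋ λ u → reverse u v) ⟩
    sum (λ v → sum (λ u → c * (π v * z v) * (P v u * h u)))
      ≈⟨ sum-cong-≋ (λ v → *-distribˡ-sum (c * (π v * z v)) λ u → P v u * h u) ⟨
    sum (λ v → c * (π v * z v) * (P ⊙ h) v)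
      ≤⟨ sum-mono zPh≤ ⟩
    sum (λ v → c * c * (π v * (f v * f v)))
      ≈⟨ *-distribˡ-sum (c * c) (λ v → π v * (f v * f v)) ⟨
    (c * c) * normSq π f ∎
    where
    open Solver using (solve; _:*_; _:=_)
    open Decay decay

    y z : Fin n → Carrier
    y v = f v * h v ⁻¹
    z v = h v * (y v * y v)

    0≤z : ∀ v → 0# ≤ z v
    0≤z v = *-nonNeg (0≤h v) (0≤x² (y v))

    -- `h w` may be 0#, where the inverse is unspecified; f w ≈ 0# makes `y w` vanish whatever its
    -- value.
    yw≈0 : y w ≈ 0#
    yw≈0 = trans (*-congʳ fw≈0) (zeroˡ _)

    hy≈f : ∀ v → h v * y v ≈ f v
    hy≈f v with em {v ≡ w}
    ... | yes ≡.refl = trans (*-congˡ yw≈0) (trans (zeroʳ (h w)) (sym fw≈0))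
    ... | no v≢w     = begin-equality
      h v * (f v * h v ⁻¹) ≈⟨ solve 3 (λ h f i → h :* (f :* i) := f :* h :* i) refl (h v) (f v) (h v ⁻¹) ⟩
      f v * h v * h v ⁻¹   ≈⟨ x*z*z⁻¹≈x (f v) (proj₂ (0<h v≢w) ∘ sym) ⟩
      f v                  ∎

    g²≤ : ∀ u → g u * g u ≤ c * h u * (P ⊙ z) u
    g²≤ u with em {u ≡ w}
    ... | yes ≡.refl = begin
      g w * g w                 ≈⟨ trans (*-congʳ gw≈0) (zeroˡ (g w)) ⟩
      0#                        ≤⟨ *-nonNeg (*-nonNeg 0≤c (0≤h w)) (sum-nonNeg λ v → *-nonNeg (0≤P w v) (0≤z v)) ⟩
      c * h w * (P ⊙ z) w       ∎
    ... | no u≢w = begin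
      g u * g u                 ≈⟨ *-cong g≈Phy g≈Phy ⟩
      sum (λ v → P u v * h v * y v) * sum (λ v → P u v * h v * y v)
        ≤⟨ cauchy-schwarz (λ v → P u v * h v) y (λ v → *-nonNeg (0≤P u v) (0≤h v)) ⟩
      (P ⊙ h) u * sum (λ v → P u v * h v * (y v * y v))
        ≈⟨ *-congˡ (sum-cong-≋ λ v → *-assoc (P u v) (h v) (y v * y v)) ⟩
      (P ⊙ h) u * (P ⊙ z) u
        ≤⟨ *-monoʳ-≤ (sum-nonNeg λ v → *-nonNeg (0≤P u v) (0≤z v)) (contracted u≢w) ⟩
      c * h u * (P ⊙ z) u       ∎
      where
      g≈Phy : g u ≈ sum (λ v → P u v * h v * y v)
      g≈Phy = trans (g≈Pf u≢w) (sum-cong-≋ λ v → trans (*-congˡ (sym (hy≈f v))) (sym (*-assoc (P u v) (h v) (y v))))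

    reverse : ∀ u v → c * (π u * h u) * (P u v * z v) ≈ c * (π v * z v) * (P v u * h u)
    reverse u v = begin-equality
      c * (π u * h u) * (P u v * z v)
        ≈⟨ solve 5 (λ c p h q z → c :* (p :* h) :* (q :* z) := c :* z :* h :* (p :* q)) refl c (π u) (h u) (P u v) (z v) ⟩
      c * z v * h u * (π u * P u v)
        ≈⟨ *-congˡ (reversible u v) ⟩
      c * z v * h u * (π v * P v u)
        ≈⟨ solve 5 (λ c p h q z → c :* z :* h :* (p :* q) := c :* (p :* z) :* (q :* h)) refl c (π v) (h u) (P v u) (z v) ⟩
      c * (π v * z v) * (P v u * h u) ∎

    -- The second factor `c` arises here, from `contracted` applied again after the exchange of
    -- sums, together with h v * z v = f v * f v. At `w`, where `contracted` says nothing, `z w` is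
    -- zero.
    zPh≤ : ∀ v → c * (π v * z v) * (P ⊙ h) v ≤ c * c * (π v * (f v * f v))
    zPh≤ v with em {v ≡ w}
    ... | yes ≡.refl = begin
      c * (π w * (h w * (y w * y w))) * (P ⊙ h) w
        ≈⟨ solve 5 (λ c p h y s → c :* (p :* (h :* (y :* y))) :* s := y :* (c :* p :* h :* y :* s)) refl c (π w) (h w) (y w) ((P ⊙ h) w) ⟩
      y w * (c * π w * h w * y w * (P ⊙ h) w)
        ≈⟨ trans (*-congʳ yw≈0) (zeroˡ _) ⟩
      0#
        ≤⟨ *-nonNeg (0≤x² c) (*-nonNeg (0≤π w) (0≤x² (f w))) ⟩
      c * c * (π w * (f w * f w)) ∎
    ... | no v≢w = begin
      c * (π v * z v) * (P ⊙ h) v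
        ≤⟨ *-monoˡ-≤ (*-nonNeg 0≤c (*-nonNeg (0≤π v) (0≤z v))) (contracted v≢w) ⟩
      c * (π v * (h v * (y v * y v))) * (c * h v)
        ≈⟨ solve 4 (λ c p h y → c :* (p :* (h :* (y :* y))) :* (c :* h) := c :* c :* (p :* ((h :* y) :* (h :* y)))) refl c (π v) (h v) (y v) ⟩
      c * c * (π v * ((h v * y v) * (h v * y v)))
        ≈⟨ *-congˡ (*-congˡ (*-cong (hy≈f v) (hy≈f v))) ⟩
      c * c * (π v * (f v * f v)) ∎

  survival-target : ∀ {n} (P : ℕ → Matrix n) w k T → survival P w k T w ≈ 0#
  survival-target P w k zero    = indicator-false λ w≢w → w≢w ≡.refl
  survival-target P w k (suc T) = trans (*-congʳ (indicator-false λ w≢w → w≢w ≡.refl)) (zeroˡ _)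

  survival-suc : ∀ {n} (P : ℕ → Matrix n) {w u} → u ≢ w → ∀ k T →
                 survival P w k (suc T) u ≈ (P k ⊙ survival P w (suc k) T) u
  survival-suc P u≢w k T = trans (*-congʳ (indicator-true u≢w)) (*-identityˡ _)

  survival-nonNeg : ∀ {n} {P : ℕ → Matrix n} → (∀ t u v → 0# ≤ P t u v) → ∀ w k T u → 0# ≤ survival P w k T u
  survival-nonNeg 0≤P w k zero    u = indicator-nonNeg (u ≢ w)
  survival-nonNeg 0≤P w k (suc T) u =
    *-nonNeg (indicator-nonNeg (u ≢ w)) (sum-nonNeg λ v → *-nonNeg (0≤P k u v) (survival-nonNeg 0≤P w (suc k) T v))

  module _ {n} {P : ℕ → Matrix n} {π : Fin n → Carrier} (transition : ∀ t → IsTransition (P t))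
           (0≤π : ∀ v → 0# ≤ π v) (Σπ≈1 : sum π ≈ 1#) (reversible : ∀ t → Reversible π (P t)) (w : Fin n) where

    -- The outermost operator belongs to the starting time k, so the induction removes `P k` and
    -- shifts k and the sequence `c` together. The base case is the norm of an indicator under a
    -- probability vector.
    normSq-survival : ∀ T k {c : ℕ → Carrier} → (∀ t → Decay (P (t ℕ.+ k)) w (c t)) →
                      let b = product {T} (c ∘ toℕ) in normSq π (survival P w k T) ≤ b * b
    normSq-survival zero k decays = begin
      sum (λ v → π v * (indicator (v ≢ w) * indicator (v ≢ w)))
        ≤⟨ sum-mono (λ v → *-monoˡ-≤ (0≤π v)
             (*-mono-≤ 0≤1 (indicator-nonNeg (v ≢ w)) (indicator≤1 (v ≢ w)) (indicator≤1 (v ≢ w)))) ⟩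
      sum (λ v → π v * (1# * 1#))
        ≈⟨ sum-cong-≋ (λ v → trans (*-congˡ (*-identityˡ 1#)) (*-identityʳ (π v))) ⟩
      sum π       ≈⟨ Σπ≈1 ⟩
      1#          ≈⟨ *-identityˡ 1# ⟨
      1# * 1#     ∎
    normSq-survival (suc T) k {c} decays = begin
      normSq π (survival P w k (suc T))
        ≤⟨ contraction 0≤π (IsTransition.nonNeg (transition k)) (reversible k) (decays 0)
             (survival-target P w (suc k) T) (survival-target P w k (suc T)) (λ u≢w → survival-suc P u≢w k T) ⟩
      c 0 * c 0 * normSq π (survival P w (suc k) T)
        ≤⟨ *-monoˡ-≤ (0≤x² (c 0)) (normSq-survival T (suc k) λ t →
             ≡.subst (λ s → Decay (P s) w (c (suc t))) (≡.sym (ℕ.+-suc t k)) (decays (suc t))) ⟩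
      c 0 * c 0 * (b * b)
        ≈⟨ solve 2 (λ c b → c :* c :* (b :* b) := c :* b :* (c :* b)) refl (c 0) b ⟩
      c 0 * b * (c 0 * b) ∎
      where
      open Solver using (solve; _:*_; _:=_)
      b = product {T} (c ∘ suc ∘ toℕ)

    survival≤product : ∀ T {c : ℕ → Carrier} → (∀ t → Decay (P t) w (c t)) →
                       sum (λ v → π v * survival P w 0 T v) ≤ product {T} (c ∘ toℕ)
    survival≤product T {c} decays = x²≤y²⇒x≤y (product-nonNeg {T} (Decay.0≤c ∘ decays ∘ toℕ)) (begin
      sum (λ v → π v * S v) * sum (λ v → π v * S v) ≤⟨ cauchy-schwarz π S 0≤π ⟩
      sum π * normSq π S                        ≈⟨ trans (*-congʳ Σπ≈1) (*-identityˡ _) ⟩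
      normSq π S                                ≤⟨ normSq-survival T 0 (λ t → ≡.subst (λ s → Decay (P s) w (c t)) (≡.sym (ℕ.+-identityʳ t)) (decays t)) ⟩
      b * b                                         ∎)
      where
      S = survival P w 0 T
      b = product {T} (c ∘ toℕ)

-- Elementary probability derived from countable additivity.

module Probability (em : ExcludedMiddle 0ℓ) (ℝ : CompleteOrderedField)
                   (space : MarkovChains.ProbabilitySpace em ℝ) where

  open MarkovChains em ℝ hiding (zero)
  open OrderedField em ℝ
  open Exponential em ℝ using (limit-≤; limit-≥)
  open ProbabilitySpace space
  open ≤-Reasoning

  ¬¬-elim : ∀ {A : Set} → ¬ ¬ A → A
  ¬¬-elim = decidable-stable em

  measurable-⋂ : ∀ (A : ℕ → Pred Ω 0ℓ) → (∀ i → Measurable (A i)) → Measurable (λ ω → ∀ i → A i ω)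
  measurable-⋂ A measurable = measurable-resp
    ((λ none i → ¬¬-elim λ ¬Ai → none (i , ¬Ai)) , λ all (i , ¬Ai) → ¬Ai (all i))
    (measurable-∁ (measurable-⋃ (λ i → ∁ (A i)) λ i → measurable-∁ (measurable i)))

  measurable-∩ : ∀ {A B} → Measurable A → Measurable B → Measurable (A ∩ B)
  measurable-∩ {A} {B} mA mB = measurable-resp
    ((λ both → both 0 , both 1) , λ (a , b) → λ { zero → a ; (suc _) → b })
    (measurable-⋂ (λ { zero → A ; (suc _) → B }) λ { zero → mA ; (suc _) → mB })

  measurable-constant : ∀ D → Measurable (λ _ → D)
  measurable-constant D with em {D}
  ... | yes d = measurable-resp ((λ _ → d) , λ _ → tt) measurable-U
  ... | no ¬d = measurable-resp ((λ ¬⊤ → contradiction tt ¬⊤) , λ d → contradiction d ¬d) (measurable-∁ measurable-U)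

  -- Guards such as s ≤ k do not depend on ω; with them, events over a bounded range of times become
  -- countable intersections over all times.
  measurable-⇒ : ∀ D {A} → Measurable A → Measurable (λ ω → D → A ω)
  measurable-⇒ D {A} mA with em {D}
  ... | yes d = measurable-resp ((λ a _ → a) , λ f → f d) mA
  ... | no ¬d = measurable-resp ((λ _ d → contradiction d ¬d) , λ _ → tt) measurable-U

  -- The constant sequence A, A, ... is pairwise disjoint because A is empty, and its union is A
  -- again. Additivity then makes p the limit of its own multiples, so p + p ≤ p.
  Pr-empty : ∀ {A} → Measurable A → (∀ ω → ¬ A ω) → Pr A ≈ 0#
  Pr-empty {A} mA ¬A = antisym (+-cancelʳ-≤ p (≤-respʳ (sym (+-identityˡ p)) p+p≤p)) (Pr-nonNeg mA)
    where
    p = Pr A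

    limit : (λ N → sum {N} (λ _ → p)) ⟶ Pr (⋃ ℕ (λ _ → A))
    limit = Pr-additive (λ _ → A) (λ _ → mA) (λ _ _ _ ω a _ → ¬A ω a)

    p+p≤p : p + p ≤ p
    p+p≤p = begin
      p + p           ≈⟨ +-congˡ (+-identityʳ p) ⟨
      p + (p + 0#)    ≤⟨ limit-≥ limit 2 (λ N 2≤N → sum-mono-length {λ _ → p} (λ _ → Pr-nonNeg mA) 2≤N) ⟩
      Pr (⋃ ℕ (λ _ → A)) ≈⟨ Pr-cong (proj₂ , (0 ,_)) (measurable-⋃ (λ _ → A) λ _ → mA) ⟩
      p               ∎

  -- Finite additivity, obtained by padding: numbering the values of Y by `toℕ`, the events of index
  -- m and beyond are empty, so the partial sums are constant from m on and equal their limit.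
  total-probability : ∀ {m} (Y : Ω → Fin m) → (∀ v → Measurable (λ ω → Y ω ≡ v)) →
                      ∀ {A} → Measurable A → Pr A ≈ sum (λ v → Pr (A ∩ (λ ω → Y ω ≡ v)))
  total-probability {m} Y mY {A} mA = begin-equality
    Pr A          ≈⟨ Pr-cong ((λ {ω} a → toℕ (Y ω) , a , ≡.refl) , λ (_ , a , _) → a) mA ⟩
    Pr (⋃ ℕ E)    ≈⟨ antisym (limit-≤ limit m λ N m≤N → ≤-reflexive (sums m≤N))
                             (limit-≥ limit m λ N m≤N → ≤-reflexive (sym (sums m≤N))) ⟩
    sum {m} (λ v → Pr (E (toℕ v)))
      ≈⟨ sum-cong-≋ {m} (λ v → Pr-cong (level v) (mE (toℕ v))) ⟩
    sum (λ v → Pr (A ∩ (λ ω → Y ω ≡ v))) ∎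
    where
    E : ℕ → Pred Ω 0ℓ
    E i = A ∩ (λ ω → toℕ (Y ω) ≡ i)

    level : ∀ v → E (toℕ v) ≐ A ∩ (λ ω → Y ω ≡ v)
    level v = (λ (a , eq) → a , toℕ-injective eq) , λ (a , eq) → a , ≡.cong toℕ eq

    E-empty : ∀ i → m ℕ.≤ i → ∀ ω → ¬ E i ω
    E-empty i m≤i ω (_ , eq) = ℕ.<⇒≱ (toℕ<n (Y ω)) (ℕ.≤-trans m≤i (ℕ.≤-reflexive (≡.sym eq)))

    mE : ∀ i → Measurable (E i)
    mE i with i ℕ.<? m
    ... | yes i<m = ≡.subst (λ j → Measurable (E j)) (toℕ-fromℕ< i<m)
                      (measurable-resp (≐-sym (level _)) (measurable-∩ mA (mY (fromℕ< i<m))))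
    ... | no i≮m  = measurable-resp ((λ ()) , λ {ω} → E-empty i (ℕ.≮⇒≥ i≮m) ω) (measurable-constant ⊥)

    limit : (λ N → sum {N} (λ i → Pr (E (toℕ i)))) ⟶ Pr (⋃ ℕ E)
    limit = Pr-additive E mE λ i j i≢j ω (_ , eqᵢ) (_ , eqⱼ) → i≢j (≡.trans (≡.sym eqᵢ) eqⱼ)

    sums : ∀ {N} → m ℕ.≤ N → sum {N} (λ i → Pr (E (toℕ i))) ≈ sum {m} (λ v → Pr (E (toℕ v)))
    sums m≤N = sum-extend {λ i → Pr (E i)} m≤N λ i m≤i → Pr-empty (mE i) (E-empty i m≤i)

  -- The two-valued variable `χ` that decides A splits Pr B into two non-negative terms, one of
  -- which is Pr A.
  Pr-mono : ∀ {A B} → Measurable A → Measurable B → (∀ {ω} → A ω → B ω) → Pr A ≤ Pr B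
  Pr-mono {A} {B} mA mB A⊆B = begin
    Pr A                                     ≈⟨ Pr-cong ((λ a → A⊆B a , χ-true a) , χ-sound ∘ proj₂) mA ⟩
    Pr (B ∩ (λ ω → χ ω ≡ zero))              ≤⟨ term≤sum (λ v → Pr-nonNeg (measurable-∩ mB (mχ v))) zero ⟩
    sum (λ v → Pr (B ∩ (λ ω → χ ω ≡ v)))     ≈⟨ total-probability χ mχ mB ⟨
    Pr B                                     ∎
    where
    χ : Ω → Fin 2
    χ ω = if does (em {A ω}) then zero else suc zero

    χ-true : ∀ {ω} → A ω → χ ω ≡ zero
    χ-true {ω} a with em {A ω}
    ... | yes _ = ≡.refl
    ... | no ¬a = contradiction a ¬a

    χ-false : ∀ {ω} → ¬ A ω → χ ω ≡ suc zero
    χ-false {ω} ¬a with em {A ω}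
    ... | yes a = contradiction a ¬a
    ... | no _  = ≡.refl

    χ-sound : ∀ {ω} → χ ω ≡ zero → A ω
    χ-sound {ω} eq with em {A ω}
    χ-sound eq | yes a = a
    χ-sound () | no _

    χ-complete : ∀ {ω} → χ ω ≡ suc zero → ¬ A ω
    χ-complete {ω} eq with em {A ω}
    χ-complete () | yes _
    χ-complete eq | no ¬a = ¬a

    mχ : ∀ v → Measurable (λ ω → χ ω ≡ v)
    mχ zero       = measurable-resp (χ-true , χ-sound) mA
    mχ (suc zero) = measurable-resp (χ-false , χ-complete) (measurable-∁ mA)

-- Comparison of the walk with the survival recursion.

module Walks (em : ExcludedMiddle 0ℓ) (ℝ : CompleteOrderedField) {n} {P : ℕ → MarkovChains.Matrix em ℝ n}
             (0≤P : ∀ t u v → CompleteOrderedField._≤_ ℝ (CompleteOrderedField.0# ℝ) (P t u v))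
             (walk : MarkovChains.RandomWalk em ℝ P) (w : Fin n) where

  open MarkovChains em ℝ hiding (zero)
  open OrderedField em ℝ
  open HittingTimes em ℝ using (_⊙_; indicator-true)
  open Survival em ℝ
  open RandomWalk walk
  open Probability em ℝ space
  open ≤-Reasoning

  -- Avoidance over the times k, ... , k + T, arranged to follow the recursion of `survival`.
  Avoid : ℕ → ℕ → Pred Ω 0ℓ
  Avoid k zero    ω = X k ω ≢ w
  Avoid k (suc T) ω = X k ω ≢ w × Avoid (suc k) T ω

  avoid : ∀ T k {ω} → (∀ t → t ℕ.≤ T ℕ.+ k → X t ω ≢ w) → Avoid k T ω
  avoid zero    k X≢w = X≢w k ℕ.≤-refl
  avoid (suc T) k X≢w = X≢w k (ℕ.m≤n+m k (suc T)) ,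
    avoid T (suc k) λ t t≤ → X≢w t (ℕ.≤-trans t≤ (ℕ.≤-reflexive (ℕ.+-suc T k)))

  Avoid-start : ∀ k T {ω} → Avoid k T ω → X k ω ≢ w
  Avoid-start k zero    Xk≢w       = Xk≢w
  Avoid-start k (suc T) (Xk≢w , _) = Xk≢w

  measurable-X≢ : ∀ t → Measurable (λ ω → X t ω ≢ w)
  measurable-X≢ t = measurable-∁ (X-measurable t w)

  measurable-Avoid : ∀ k T → Measurable (Avoid k T)
  measurable-Avoid k zero    = measurable-X≢ k
  measurable-Avoid k (suc T) = measurable-∩ (measurable-X≢ k) (measurable-Avoid (suc k) T)

  measurable-History : ∀ k x → Measurable (History k x)
  measurable-History k x = measurable-⋂ (λ s ω → s ℕ.≤ k → X s ω ≡ x s) λ s → measurable-⇒ (s ℕ.≤ k) (X-measurable s (x s))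

  -- The Markov property speaks only of histories of positive probability. For the others the left
  -- side is at most the probability of the history, hence 0. Otherwise the event X k = x k contains
  -- the history, so it has positive probability and `transition` applies to it.
  Pr-step : ∀ k x v → Pr (History k x ∩ (λ ω → X (suc k) ω ≡ v)) ≤ Pr (History k x) * P k (x k) v
  Pr-step k x v with em {0# ≈ Pr (History k x)}
  ... | yes 0≈p = begin
    Pr (History k x ∩ (λ ω → X (suc k) ω ≡ v)) ≤⟨ Pr-mono (measurable-∩ mH (X-measurable (suc k) v)) mH proj₁ ⟩
    Pr (History k x)                           ≈⟨ 0≈p ⟨
    0#                                         ≤⟨ *-nonNeg (Pr-nonNeg mH) (0≤P k (x k) v) ⟩
    Pr (History k x) * P k (x k) v             ∎
    where mH = measurable-History k x
  ... | no 0≉p = begin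
    Pr (H ∩ N)                ≈⟨ Pr-cong ((λ (a , b) → b , a) , λ (a , b) → b , a) (measurable-∩ mH (X-measurable (suc k) v)) ⟩
    q                         ≈⟨ trans (*-congʳ (*-comm p (p ⁻¹))) (trans (*-congʳ (⁻¹-inverse (0≉p ∘ sym))) (*-identityˡ q)) ⟨
    p * p ⁻¹ * q              ≈⟨ trans (*-assoc p _ q) (*-congˡ (*-comm _ q)) ⟩
    p * Pr[ N ∣ H ]           ≈⟨ *-congˡ (trans (markov k x v 0<p) (transition k (x k) v (<-≤-trans 0<p p≤Pr[Xk≡xk]))) ⟩
    p * P k (x k) v           ∎
    where
    H = History k x
    N = λ ω → X (suc k) ω ≡ v
    p = Pr H
    q = Pr (N ∩ H)
    mH = measurable-History k x
    0<p : 0# < p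
    0<p = Pr-nonNeg mH , 0≉p
    p≤Pr[Xk≡xk] : p ≤ Pr (λ ω → X k ω ≡ x k)
    p≤Pr[Xk≡xk] = Pr-mono mH (X-measurable k (x k)) λ h → h k ℕ.≤-refl

  -- Every value after time k is set to v; `History (suc k)` reads only the first of these.
  extend : ℕ → (ℕ → Fin n) → Fin n → ℕ → Fin n
  extend k x v s with s ℕ.≤? k
  ... | yes _ = x s
  ... | no _  = v

  extend-≤ : ∀ {k x v s} → s ℕ.≤ k → extend k x v s ≡ x s
  extend-≤ {k} {s = s} s≤k with s ℕ.≤? k
  ... | yes _  = ≡.refl
  ... | no s≰k = contradiction s≤k s≰k

  extend-suc : ∀ {k x v} → extend k x v (suc k) ≡ v
  extend-suc {k} with suc k ℕ.≤? k
  ... | yes k<k = contradiction k<k (ℕ.<-irrefl ≡.refl)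
  ... | no _    = ≡.refl

  History-extend : ∀ {k x v ω} → History k x ω → X (suc k) ω ≡ v → History (suc k) (extend k x v) ω
  History-extend {k} h X≡v s s≤1+k with s ℕ.≤? k
  ... | yes s≤k = h s s≤k
  ... | no s≰k with ≡.refl ← ℕ.≤-antisym s≤1+k (ℕ.≰⇒> s≰k) = X≡v

  History-restrict : ∀ {k x v ω} → History (suc k) (extend k x v) ω → History k x ω × X (suc k) ω ≡ v
  History-restrict {k} {x} {v} h =
    (λ s s≤k → ≡.trans (h s (ℕ.≤-trans s≤k (ℕ.n≤1+n k))) (extend-≤ s≤k)) , ≡.trans (h (suc k) ℕ.≤-refl) (extend-suc {k} {x} {v})

  -- The induction carries the whole history rather than the current vertex, since that is the event
  -- on which the Markov property conditions. Splitting by the value of X at time suc k lengthens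
  -- the history by one vertex, and `Pr-step` supplies the factor `P k (x k) v`.
  Pr-avoid : ∀ T k x → Pr (History k x ∩ Avoid k T) ≤ Pr (History k x) * survival P w k T (x k)
  Pr-avoid T k x with em {x k ≡ w}
  Pr-avoid T k x | yes xk≡w = begin
    Pr (History k x ∩ Avoid k T)                  ≈⟨ Pr-empty (measurable-∩ (measurable-History k x) (measurable-Avoid k T))
                                                       (λ ω (h , a) → Avoid-start k T a (≡.trans (h k ℕ.≤-refl) xk≡w)) ⟩
    0#                                            ≤⟨ *-nonNeg (Pr-nonNeg (measurable-History k x)) (survival-nonNeg 0≤P w k T (x k)) ⟩
    Pr (History k x) * survival P w k T (x k)     ∎
  Pr-avoid zero k x | no xk≢w = begin
    Pr (History k x ∩ Avoid k 0)                  ≤⟨ Pr-mono (measurable-∩ mH (measurable-Avoid k 0)) mH proj₁ ⟩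
    Pr (History k x)                              ≈⟨ trans (*-congˡ (indicator-true xk≢w)) (*-identityʳ _) ⟨
    Pr (History k x) * survival P w k 0 (x k)     ∎
    where mH = measurable-History k x
  Pr-avoid (suc T) k x | no xk≢w = begin
    Pr (H ∩ Avoid k (suc T))
      ≤⟨ Pr-mono (measurable-∩ mH (measurable-Avoid k (suc T))) mHA (λ (h , _ , a) → h , a) ⟩
    Pr (H ∩ A)
      ≈⟨ total-probability (X (suc k)) (X-measurable (suc k)) mHA ⟩
    sum (λ v → Pr ((H ∩ A) ∩ (λ ω → X (suc k) ω ≡ v)))
      ≤⟨ sum-mono (λ v → Pr-mono (measurable-∩ mHA (X-measurable (suc k) v)) (measurable-∩ (mH⁺ v) mA)
           (λ ((h , a) , X≡v) → History-extend h X≡v , a)) ⟩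
    sum (λ v → Pr (H⁺ v ∩ A))
      ≤⟨ sum-mono (λ v → Pr-avoid T (suc k) (extend k x v)) ⟩
    sum (λ v → Pr (H⁺ v) * S (extend k x v (suc k)))
      ≤⟨ sum-mono (λ v → *-mono-≤ (*-nonNeg (Pr-nonNeg mH) (0≤P k (x k) v)) (0≤S _) (Pr-H⁺ v)
           (≤-reflexive (reflexive (≡.cong S (extend-suc {k} {x} {v}))))) ⟩
    sum (λ v → Pr H * P k (x k) v * S v)
      ≈⟨ sum-cong-≋ (λ v → *-assoc (Pr H) (P k (x k) v) (S v)) ⟩
    sum (λ v → Pr H * (P k (x k) v * S v))
      ≈⟨ *-distribˡ-sum (Pr H) (λ v → P k (x k) v * S v) ⟨
    Pr H * (P k ⊙ S) (x k)
      ≈⟨ *-congˡ (survival-suc P xk≢w k T) ⟨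
    Pr H * survival P w k (suc T) (x k) ∎
    where
    H = History k x
    H⁺ = λ v → History (suc k) (extend k x v)
    A = Avoid (suc k) T
    S = survival P w (suc k) T
    mH = measurable-History k x
    mH⁺ = λ v → measurable-History (suc k) (extend k x v)
    mA = measurable-Avoid (suc k) T
    mHA = measurable-∩ mH mA
    0≤S = survival-nonNeg 0≤P w (suc k) T
    Pr-H⁺ : ∀ v → Pr (H⁺ v) ≤ Pr H * P k (x k) v
    Pr-H⁺ v = ≤-trans (Pr-mono (mH⁺ v) (measurable-∩ mH (X-measurable (suc k) v)) History-restrict) (Pr-step k x v)

  Pr-avoid≤survival : ∀ T → Pr (λ ω → ∀ t → t ℕ.≤ T → X t ω ≢ w) ≤
                            sum (λ v → Pr (λ ω → X 0 ω ≡ v) * survival P w 0 T v)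
  Pr-avoid≤survival T = begin
    Pr B
      ≈⟨ total-probability (X 0) (X-measurable 0) mB ⟩
    sum (λ v → Pr (B ∩ (λ ω → X 0 ω ≡ v)))
      ≤⟨ sum-mono (λ v → Pr-mono (measurable-∩ mB (X-measurable 0 v))
           (measurable-∩ (measurable-History 0 (λ _ → v)) (measurable-Avoid 0 T))
           (λ (b , X≡v) → (λ { zero _ → X≡v }) , avoid T 0 λ t t≤ → b t (ℕ.≤-trans t≤ (ℕ.≤-reflexive (ℕ.+-identityʳ T))))) ⟩
    sum (λ v → Pr (History 0 (λ _ → v) ∩ Avoid 0 T))
      ≤⟨ sum-mono (λ v → Pr-avoid T 0 (λ _ → v)) ⟩
    sum (λ v → Pr (History 0 (λ _ → v)) * survival P w 0 T v)
      ≈⟨ sum-cong-≋ (λ v → *-congʳ (Pr-cong ((λ h → h 0 ℕ.z≤n) , λ X≡v → λ { zero _ → X≡v }) (measurable-History 0 (λ _ → v)))) ⟩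
    sum (λ v → Pr (λ ω → X 0 ω ≡ v) * survival P w 0 T v) ∎
    where
    B : Pred Ω 0ℓ
    B ω = ∀ t → t ℕ.≤ T → X t ω ≢ w
    mB = measurable-⋂ (λ t ω → t ℕ.≤ T → X t ω ≢ w) λ t → measurable-⇒ (t ℕ.≤ T) (measurable-X≢ t)

-- The exponential bound on the product, and the theorem.

module _ (em : ExcludedMiddle 0ℓ) (ℝ : CompleteOrderedField) where

  open MarkovChains em ℝ hiding (zero)
  open OrderedField em ℝ
  open Exponential em ℝ using ([1-r]^T≤exp)
  open HittingTimes em ℝ
  open ≤-Reasoning

  -- Each factor is at most 1 - 1/K, where K is the value of `tHIT P`. Comparing reciprocals
  -- requires every `tHit (P t)` to be positive; `w` and a second vertex show that it is at least 1.
  product≤exp : ∀ {n} → 2 ℕ.≤ n → {P : ℕ → Matrix n} → (∀ t → IsTransition (P t)) → (∀ t → Irreducible (P t)) →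
                Fin n → ∀ T → IsFinite (tHIT P) →
                product {T} (λ t → 1# - recip (tHit (P (toℕ t)))) ≤ exp (- (fromℕ T * recip (tHIT P)))
  product≤exp 2≤n {P} transition irreducible w T finite with tHIT P in tHIT≡
  ... | fin K = begin
    product {T} (λ t → 1# - recip (tHit (P (toℕ t))))
      ≤⟨ product≤^ {T} (x≤y⇒0≤y-x K⁻¹≤1) (λ t → Decay.0≤c (decay 2≤n (transition (toℕ t)) (irreducible (toℕ t)) w))
           (λ t → +-mono-≤ ≤-refl (neg-antitone (K⁻¹≤recip (toℕ t)))) ⟩
    (1# - K ⁻¹) ^ T               ≤⟨ [1-r]^T≤exp (0<x⇒0≤x⁻¹ 0<K) K⁻¹≤1 T ⟩
    exp (- (fromℕ T * K ⁻¹))      ∎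
    where
    tHit≤K : ∀ t → ∃ λ x → tHit (P t) ≡ fin x × x ≤ K
    tHit≤K = proj₂ (proj₁ (⨆-fin tHIT≡))

    1≤tHit : ∀ t → 1# ≤ proj₁ (tHit≤K t)
    1≤tHit t = 1≤H (transition t) (irreducible t) (proj₁ (proj₂ (tHit≤K t))) w (proj₂ (otherVertex 2≤n w))

    1≤K : 1# ≤ K
    1≤K = ≤-trans (1≤tHit 0) (proj₂ (proj₂ (tHit≤K 0)))

    0<K = <-≤-trans 0<1 1≤K

    K⁻¹≤1 : K ⁻¹ ≤ 1#
    K⁻¹≤1 = ≤-respʳ 1⁻¹≈1 (⁻¹-antitone 0<1 1≤K)

    K⁻¹≤recip : ∀ t → K ⁻¹ ≤ recip (tHit (P t))
    K⁻¹≤recip t with tHit≤K t | 1≤tHit t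
    ... | x , eq , x≤K | 1≤x rewrite eq = ⁻¹-antitone (<-≤-trans 0<1 1≤x) x≤K

lemma1p11 :
  (em : ExcludedMiddle 0ℓ) (ℝ : CompleteOrderedField) →
  let open MarkovChains em ℝ in
  (n : ℕ) → 2 ℕ.≤ n →
  (P : ℕ → Matrix n) (π : Fin n → Carrier) →
  (∀ t → IsTransition (P t)) →
  (∀ t → Irreducible (P t)) →
  (∀ t → IsStationary π (P t)) →
  (∀ t → Reversible π (P t)) →
  (walk : RandomWalk P) →
  let open RandomWalk walk in
  (∀ v → Pr (λ ω → X 0 ω ≡ v) ≈ π v) →
  (w : Fin n) (T : ℕ) →
  let bound = product {T} (λ t → 1# - recip (tHit (P (toℕ t)))) in
  Pr (λ ω → ∀ t → t ℕ.≤ T → X t ω ≢ w) ≤ bound ×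
  (IsFinite (tHIT P) → bound ≤ exp (- (fromℕ T * recip (tHIT P))))
lemma1p11 em ℝ n 2≤n P π transition irreducible stationary reversible walk X₀∼π w T =
  avoid≤product , product≤exp em ℝ 2≤n transition irreducible w T
  where
  open MarkovChains em ℝ hiding (zero)
  open OrderedField em ℝ
  open HittingTimes em ℝ using (decay)
  open Survival em ℝ
  open Walks em ℝ (λ t → IsTransition.nonNeg (transition t)) walk w using (Pr-avoid≤survival)
  open RandomWalk walk using (Pr; X)
  open ≤-Reasoning

  avoid≤product : Pr (λ ω → ∀ t → t ℕ.≤ T → X t ω ≢ w) ≤ product {T} (λ t → 1# - recip (tHit (P (toℕ t))))
  avoid≤product = begin
    Pr (λ ω → ∀ t → t ℕ.≤ T → X t ω ≢ w)
      ≤⟨ Pr-avoid≤survival T ⟩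
    sum (λ v → Pr (λ ω → X 0 ω ≡ v) * survival P w 0 T v)
      ≈⟨ sum-cong-≋ (λ v → *-congʳ (X₀∼π v)) ⟩
    sum (λ v → π v * survival P w 0 T v)
      ≤⟨ survival≤product transition (IsStationary.nonNeg (stationary 0)) (IsStationary.total (stationary 0)) reversible w T
           (λ t → decay 2≤n (transition t) (irreducible t) w) ⟩
    product {T} (λ t → 1# - recip (tHit (P (toℕ t)))) ∎
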